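{- For every positive integer $n$: (a) $\mathcal{J}_{10}(2n)$ and $\mathcal{J}_{10}(8n+3)$ are even; (b) for each $i\in\{0,1,2\}$, $\mathcal{J}^*_{10}(4n+i)$ is even.
   Context: Let $q=e^{2\pi i\tau}$ with $\tau$ in the upper half-plane, and let $\eta(\tau)=q^{1/24}\prod_{n\ge1}(1-q^n)$ be the Dedekind eta function. Define the Hauptmoduln \[ j_{10}(\tau)=\frac{\eta(2\tau)\eta(5\tau)^5}{\eta(\tau)\eta(10\tau)^5}-1=\frac1q+\sum_{n\ge1}\mathcal{J}_{10}(n)q^n, \] \[ j_{10}^*(\tau)=\left(\frac{\eta(\tau)\eta(5\tau)}{\eta(2\tau)\eta(10\tau)}\right)^4+4+2^4\left(\frac{\eta(2\tau)\eta(10\tau)}{\eta(\tau)\eta(5\tau)}\right)^4=\frac1q+\sum_{n\ge0}\mathcal{J}^*_{10}(n)q^n, \] so $\mathcal{J}_{10}(n)$ and $\mathcal{J}^*_{10}(n)$ denote their $n$-th Fourier coefficients (integers). -}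

module Defs where

open import Data.Nat as ℕ using (ℕ; zero; suc; _∸_; _≡ᵇ_)
open import Data.Nat.Divisibility using (_∣?_)
open import Data.Integer using (ℤ; +_; -[1+_]; _+_; _*_; _-_; -_)
open import Data.Bool using (if_then_else_)
open import Data.List using (List; []; _∷_; foldr)
open import Data.Product using (_×_; _,_)
open import Relation.Nullary.Decidable using (⌊_⌋)

-- Formal power series in q with integer coefficients: k ↦ coefficient of q^k.
Series : Set
Series = ℕ → ℤ

sumTo : (ℕ → ℤ) → ℕ → ℤ
sumTo f zero    = f zero
sumTo f (suc k) = sumTo f k + f (suc k)

_⊛_ : Series → Series → Series
(f ⊛ g) k = sumTo (λ i → f i * g (k ∸ i)) k

one : Series
one zero    = + 1
one (suc _) = + 0

-- 1 - q^m   (used only with m ≥ 1)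
oneMinus : ℕ → Series
oneMinus m k = if k ≡ᵇ 0 then + 1 else (if k ≡ᵇ m then - (+ 1) else + 0)

-- 1/(1 - q^m) = Σ_j q^{mj}   (used only with m ≥ 1)
geom : ℕ → Series
geom m k = if ⌊ m ∣? k ⌋ then + 1 else + 0

pow : Series → ℕ → Series
pow s zero    = one
pow s (suc e) = s ⊛ pow s e

factor : ℕ → ℤ → Series
factor m (+ e)     = pow (oneMinus m) e
factor m -[1+ e ]  = pow (geom m) (suc e)

etaProdUpTo : List (ℕ × ℤ) → ℕ → Series
etaProdUpTo ds zero    = one
etaProdUpTo ds (suc N) =
  etaProdUpTo ds N ⊛ foldr (λ { (d , r) acc → factor (d ℕ.* suc N) r ⊛ acc }) one ds

-- Coefficient of q^k in the infinite product ∏_{n≥1} ∏_{(d,r)} (1 - q^{d n})^r.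
-- Factors with n > k are 1 + O(q^{k+1}), so truncating at N = k is exact.
etaProdCoeff : List (ℕ × ℤ) → ℕ → ℤ
etaProdCoeff ds k = etaProdUpTo ds k k

δ₀ : ℕ → ℤ
δ₀ zero    = + 1
δ₀ (suc _) = + 0

-- j_10 + 1 = q^{-1} ∏ (1-q^{2n})(1-q^{5n})^5 / ((1-q^n)(1-q^{10n})^5)
j10Exps : List (ℕ × ℤ)
j10Exps = (2 , + 1) ∷ (5 , + 5) ∷ (1 , - (+ 1)) ∷ (10 , - (+ 5)) ∷ []

-- 𝒥₁₀(n) : coefficient of q^n in j_10 (for n ≥ 0; the constant term is 0)
J10 : ℕ → ℤ
J10 n = etaProdCoeff j10Exps (suc n) - δ₀ n

-- (η(τ)η(5τ)/(η(2τ)η(10τ)))^4 = q^{-1} ∏ ((1-q^n)(1-q^{5n})/((1-q^{2n})(1-q^{10n})))^4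
PExps : List (ℕ × ℤ)
PExps = (1 , + 4) ∷ (5 , + 4) ∷ (2 , - (+ 4)) ∷ (10 , - (+ 4)) ∷ []

-- (η(2τ)η(10τ)/(η(τ)η(5τ)))^4 = q ∏ ((1-q^{2n})(1-q^{10n})/((1-q^n)(1-q^{5n})))^4
QExps : List (ℕ × ℤ)
QExps = (2 , + 4) ∷ (10 , + 4) ∷ (1 , - (+ 4)) ∷ (5 , - (+ 4)) ∷ []

J10* : ℕ → ℤ
J10* zero    = etaProdCoeff PExps 1 + + 4
J10* (suc n) = etaProdCoeff PExps (suc (suc n)) + + 16 * etaProdCoeff QExps n

{-# OPTIONS --safe #-}
module Submission where

open import Defs
open import Data.Nat using (ℕ; _+_; _*_; _≤_)
open import Data.Integer using (+_)
open import Data.Integer.Divisibility using (_∣_)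
open import Data.Fin using (Fin; toℕ)
open import Data.Product using (_×_)

open import Algebra.Bundles using (CommutativeRing)
import Algebra.Solver.Ring as RingSolver
open import Algebra.Solver.Ring.AlmostCommutativeRing using (fromCommutativeRing; _-Raw-AlmostCommutative⟶_; Induced-equivalence)
open import Data.Bool using (Bool; true; false; T; _xor_; _∧_)
import Data.Bool.Properties as Bool
open import Data.Bool.Solver using () renaming (module xor-∧-Solver to B)
open import Data.Fin using (fromℕ<)
open import Data.Fin.Patterns using (0F; 1F; 2F; 3F; 4F)
import Data.Fin.Properties as Fin
import Data.Integer as ℤ
open import Data.Integer using (ℤ; -[1+_]; _⊖_; ∣_∣; _/ℕ_)
open import Data.Integer.DivMod using (n%ℕd<d; a≡a%ℕn+[a/ℕn]*n)
import Data.Integer.Properties as ℤ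
open import Data.Integer.Solver using () renaming (module +-*-Solver to Z)
open import Data.List using (List; []; _∷_; _++_; foldr; map; cartesianProduct)
open import Data.List.Membership.Propositional using (_∈_)
open import Data.List.Membership.Propositional.Properties using (∈-map⁺; ∈-map⁻; ∈-++⁺ˡ; ∈-++⁺ʳ; ∈-cartesianProduct⁺)
open import Data.List.Relation.Binary.Disjoint.Propositional using (Disjoint)
open import Data.List.Relation.Unary.All as All using (All; []; _∷_)
open import Data.List.Relation.Unary.AllPairs using ([]; _∷_)
open import Data.List.Relation.Unary.Any using (here; there)
open import Data.List.Relation.Unary.Unique.Propositional using (Unique)
import Data.List.Relation.Unary.Unique.Propositional.Properties as Unique
import Data.Maybe as Maybe
import Data.Nat as ℕ
open import Data.Nat using (zero; suc; _∸_; _<_; _≡ᵇ_; z≤n; s≤s; _⊓_)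
open import Data.Nat.Divisibility using (_∣?_; _∣0; ∣⇒≤; ∣-refl; ∣m+n∣m⇒∣n; ∣m∣n⇒∣m+n) renaming (_∣_ to _∣ⁿ_)
import Data.Nat.Properties as ℕ
open import Data.Nat.Solver using () renaming (module +-*-Solver to N)
open import Data.Product using (_,_; proj₁; ∃₂)
open import Data.Product.Function.NonDependent.Propositional using (_×-↔_)
import Data.Product.Properties as Product
open import Data.Sum using (_⊎_; inj₁; inj₂)
open import Data.Sum.Function.Propositional using (_⊎-↔_)
import Data.Sum.Properties as Sum
open import Function.Bundles using (_↔_; Inverse; mk↔ₛ′)
open import Function.Properties.Inverse using (↔-refl; ↔-sym; ↔-trans)
open import Level using (0ℓ)
open import Relation.Binary using (DecidableEquality; IsEquivalence; Setoid; WeaklyDecidable)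
open import Relation.Binary.PropositionalEquality using (_≡_; refl; sym; trans; cong; cong₂; subst; module ≡-Reasoning)
import Relation.Binary.Reasoning.Setoid as SetoidReasoning
open import Relation.Nullary using (yes; no; ¬_; contradiction)
open import Relation.Nullary.Decidable using (dec⇒maybe; ⌊_⌋)

open B using () renaming (solve to solveBool)
open N using () renaming (solve to solveℕ)
open Z using () renaming (solve to solveℤ)

-- Everything takes place in 𝔽₂⟦q⟧, where (1 - q^{2m}) = (1 - q^m)². Write E d = ∏ (1 - q^{dn}).
-- The expansion of (η(τ)η(5τ)/η(2τ)η(10τ))⁴ is a fourth power, hence a series in q⁴; this is (b).
-- For (a), q (j₁₀ + 1) = E 1 / (E 5)⁵, and the key identity is
--   E 1 · E 5 = (E 1)⁶ + q (E 5)⁶.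
-- With w = E 1 / E 5 it gives q (j₁₀ + 1) = (w³)² + q, so only q¹ survives in odd degrees, and
-- the coefficient of q^{8n+4} is that of q^{4n+2} in w³ = ((E 1)² / E 5)⁴ + q (E 1 · E 5)², which is 0.
--
-- By the Jacobi triple product, with f(A,B) = Σ_{k∈ℤ} q^{A k(k+1)/2 + B k(k-1)/2},
-- E 1 · E 5 = f(4,1) f(3,2) and (E m)³ = f(3m,m), so the key identity reads
--   f(4,1) f(3,2) + q f(15,5)² = f(3,1)².
-- It comes from a bijection between index sets in ℤ[i]: f(3,1)² runs over the odd Gaussian integers
-- (4k+1) + (4l+1)i; those divisible by one fixed prime above 5 give q f(15,5)², and the others,
-- multiplied by its conjugate and by a unit, are the (10a+3) + (10b+1)i of f(4,1) f(3,2).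

-- Power series over 𝔽₂

-- Completing squares turns degrees into Gaussian norms. With K = 4k + 1 and L = 4l + 1, a term of
-- f(3,1)² of degree e satisfies K² + L² = 8e + 2. With X = 10a + 3 and Y = 10b + 1, a term of
-- f(4,1) f(3,2) of degree e satisfies X² + Y² = 40e + 10 = 5(8e + 2). For a term of q f(15,5)² of
-- degree e, 8e + 2 is 5 times the norm of (4s + 1) + (4t + 1)i. Multiplication by a prime of norm 5
-- therefore respects the degrees on both parts. The obstacle is that f(A,B) is an infinite sum,
-- while a series is only a function of the degree. The sum is cut to ∣k∣ ≤ n, which is exact up to
-- degree n because the k-th exponent is at least ∣k∣. The bijection acts on the full lattices and
-- is applied to one degree at a time. Since all signs of the triple product vanish modulo 2,
-- equality of theta series is a matter of counting lattice points modulo 2.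

Series₂ : Set
Series₂ = ℕ → Bool

infix 4 _≈_ _≈[_]_

record _≈_ (f g : Series₂) : Set where
  constructor mk
  field coeff : ∀ k → f k ≡ g k
open _≈_

-- Congruence modulo q^{n+1}; it stands in for q-adic convergence.
record _≈[_]_ (f : Series₂) (n : ℕ) (g : Series₂) : Set where
  constructor mk
  field coeff≤ : ∀ k → k ≤ n → f k ≡ g k
open _≈[_]_

infixl 6 _⊕_
infixl 7 _⊗_

_⊕_ : Series₂ → Series₂ → Series₂
(f ⊕ g) k = f k xor g k

tail : Series₂ → Series₂
tail f k = f (suc k)

-- Splitting off the constant term of the left factor, f = f(0) + q · `tail f`, opens the ring laws
-- to structural induction on the degree.
_⊗_ : Series₂ → Series₂ → Series₂
(f ⊗ g) zero    = f 0 ∧ g 0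
(f ⊗ g) (suc k) = (f 0 ∧ g (suc k)) xor (tail f ⊗ g) k

constant : Bool → Series₂
constant b zero    = b
constant b (suc _) = false

𝟘 𝟙 : Series₂
𝟘 _ = false
𝟙 = constant true

≈-refl : ∀ {f} → f ≈ f
≈-refl = mk λ _ → refl

≈-sym : ∀ {f g} → f ≈ g → g ≈ f
≈-sym p = mk λ k → sym (coeff p k)

≈-trans : ∀ {f g h} → f ≈ g → g ≈ h → f ≈ h
≈-trans p q = mk λ k → trans (coeff p k) (coeff q k)

≈-isEquivalence : IsEquivalence _≈_
≈-isEquivalence = record { refl = ≈-refl ; sym = ≈-sym ; trans = ≈-trans }

≈[]-trans : ∀ {f g h n} → f ≈[ n ] g → g ≈[ n ] h → f ≈[ n ] h
≈[]-trans p q = mk λ k k≤n → trans (coeff≤ p k k≤n) (coeff≤ q k k≤n)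

≈[]-sym : ∀ {f g n} → f ≈[ n ] g → g ≈[ n ] f
≈[]-sym p = mk λ k k≤n → sym (coeff≤ p k k≤n)

≈⇒≈[] : ∀ {f g n} → f ≈ g → f ≈[ n ] g
≈⇒≈[] p = mk λ k _ → coeff p k

≈[]-weaken : ∀ {f g m n} → m ≤ n → f ≈[ n ] g → f ≈[ m ] g
≈[]-weaken m≤n p = mk λ k k≤m → coeff≤ p k (ℕ.≤-trans k≤m m≤n)

≈[]-setoid : ℕ → Setoid 0ℓ 0ℓ
≈[]-setoid n = record
  { Carrier = Series₂ ; _≈_ = _≈[ n ]_
  ; isEquivalence = record { refl = ≈⇒≈[] ≈-refl ; sym = ≈[]-sym ; trans = ≈[]-trans } }

⊗-cong-≤ : ∀ k {f f′ g g′} → (∀ i → i ≤ k → f i ≡ f′ i) → (∀ i → i ≤ k → g i ≡ g′ i) →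
           (f ⊗ g) k ≡ (f′ ⊗ g′) k
⊗-cong-≤ zero    p q = cong₂ _∧_ (p 0 z≤n) (q 0 z≤n)
⊗-cong-≤ (suc k) p q = cong₂ _xor_
  (cong₂ _∧_ (p 0 z≤n) (q (suc k) ℕ.≤-refl))
  (⊗-cong-≤ k (λ i i≤k → p (suc i) (s≤s i≤k)) (λ i i≤k → q i (ℕ.m≤n⇒m≤1+n i≤k)))

⊗-cong[] : ∀ {n f f′ g g′} → f ≈[ n ] f′ → g ≈[ n ] g′ → f ⊗ g ≈[ n ] f′ ⊗ g′
⊗-cong[] p q = mk λ k k≤n → ⊗-cong-≤ k
  (λ i i≤k → coeff≤ p i (ℕ.≤-trans i≤k k≤n)) (λ i i≤k → coeff≤ q i (ℕ.≤-trans i≤k k≤n))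

⊗-cong : ∀ {f f′ g g′} → f ≈ f′ → g ≈ g′ → f ⊗ g ≈ f′ ⊗ g′
⊗-cong p q = mk λ k → ⊗-cong-≤ k (λ i _ → coeff p i) (λ i _ → coeff q i)

⊕-cong : ∀ {f f′ g g′} → f ≈ f′ → g ≈ g′ → f ⊕ g ≈ f′ ⊕ g′
⊕-cong p q = mk λ k → cong₂ _xor_ (coeff p k) (coeff q k)

⊕-cong[] : ∀ {n f f′ g g′} → f ≈[ n ] f′ → g ≈[ n ] g′ → f ⊕ g ≈[ n ] f′ ⊕ g′
⊕-cong[] p q = mk λ k k≤n → cong₂ _xor_ (coeff≤ p k k≤n) (coeff≤ q k k≤n)

⊗-zeroˡ : ∀ g k → (𝟘 ⊗ g) k ≡ false
⊗-zeroˡ g zero    = refl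
⊗-zeroˡ g (suc k) = ⊗-zeroˡ g k

constant-⊗ : ∀ b g k → (constant b ⊗ g) k ≡ b ∧ g k
constant-⊗ b g zero    = refl
constant-⊗ b g (suc k) = trans (cong ((b ∧ g (suc k)) xor_) (⊗-zeroˡ g k)) (Bool.xor-identityʳ _)

xor-interchange : ∀ a b c d → (a xor b) xor (c xor d) ≡ (a xor c) xor (b xor d)
xor-interchange = solveBool 4 (λ a b c d → (a B.:+ b) B.:+ (c B.:+ d) B.:= (a B.:+ c) B.:+ (b B.:+ d)) refl

⊗-distribʳ : ∀ f g h k → ((g ⊕ h) ⊗ f) k ≡ (g ⊗ f) k xor (h ⊗ f) k
⊗-distribʳ f g h zero    = Bool.∧-distribʳ-xor (f 0) (g 0) (h 0)
⊗-distribʳ f g h (suc k) = trans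
  (cong₂ _xor_ (Bool.∧-distribʳ-xor (f (suc k)) (g 0) (h 0)) (⊗-distribʳ f (tail g) (tail h) k))
  (xor-interchange (g 0 ∧ f (suc k)) _ _ _)

⊗-scaleˡ : ∀ b g h k → ((λ i → b ∧ g i) ⊗ h) k ≡ b ∧ (g ⊗ h) k
⊗-scaleˡ b g h zero    = Bool.∧-assoc b _ _
⊗-scaleˡ b g h (suc k) = trans
  (cong₂ _xor_ (Bool.∧-assoc b _ _) (⊗-scaleˡ b (tail g) h k))
  (sym (Bool.∧-distribˡ-xor b _ _))

⊗-assoc : ∀ f g h k → ((f ⊗ g) ⊗ h) k ≡ (f ⊗ (g ⊗ h)) k
⊗-assoc f g h zero    = Bool.∧-assoc (f 0) _ _
⊗-assoc f g h (suc k) = begin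
  ((f 0 ∧ g 0) ∧ h (suc k)) xor (((λ i → f 0 ∧ g (suc i)) ⊕ (tail f ⊗ g)) ⊗ h) k
    ≡⟨ cong (((f 0 ∧ g 0) ∧ h (suc k)) xor_) (⊗-distribʳ h _ _ k) ⟩
  ((f 0 ∧ g 0) ∧ h (suc k)) xor (((λ i → f 0 ∧ g (suc i)) ⊗ h) k xor ((tail f ⊗ g) ⊗ h) k)
    ≡⟨ cong (((f 0 ∧ g 0) ∧ h (suc k)) xor_)
         (cong₂ _xor_ (⊗-scaleˡ (f 0) (tail g) h k) (⊗-assoc (tail f) g h k)) ⟩
  ((f 0 ∧ g 0) ∧ h (suc k)) xor ((f 0 ∧ (tail g ⊗ h) k) xor (tail f ⊗ (g ⊗ h)) k)
    ≡⟨ solveBool 5 (λ a b c d e → (a B.:* b) B.:* c B.:+ (a B.:* d B.:+ e) B.:= a B.:* (b B.:* c B.:+ d) B.:+ e) refl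
         (f 0) (g 0) (h (suc k)) ((tail g ⊗ h) k) ((tail f ⊗ (g ⊗ h)) k) ⟩
  (f ⊗ (g ⊗ h)) (suc k) ∎
  where open ≡-Reasoning

⊗-sucʳ : ∀ f g k → (f ⊗ g) (suc k) ≡ (f (suc k) ∧ g 0) xor (f ⊗ tail g) k
⊗-sucʳ f g zero    = Bool.xor-comm (f 0 ∧ g 1) (f 1 ∧ g 0)
⊗-sucʳ f g (suc k) = trans
  (cong ((f 0 ∧ g (2 + k)) xor_) (⊗-sucʳ (tail f) g k))
  (solveBool 3 (λ a b c → a B.:+ (b B.:+ c) B.:= b B.:+ (a B.:+ c)) refl
    (f 0 ∧ g (2 + k)) (f (2 + k) ∧ g 0) ((tail f ⊗ tail g) k))

⊗-comm : ∀ f g k → (f ⊗ g) k ≡ (g ⊗ f) k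
⊗-comm f g zero    = Bool.∧-comm (f 0) (g 0)
⊗-comm f g (suc k) = trans
  (cong₂ _xor_ (Bool.∧-comm (f 0) _) (⊗-comm (tail f) g k))
  (sym (⊗-sucʳ g f k))

series₂ : CommutativeRing 0ℓ 0ℓ
series₂ = record
  { Carrier = Series₂ ; _≈_ = _≈_ ; _+_ = _⊕_ ; _*_ = _⊗_ ; -_ = λ f → f ; 0# = 𝟘 ; 1# = 𝟙
  ; isCommutativeRing = record
    { isRing = record
      { +-isAbelianGroup = record
        { isGroup = record
          { isMonoid = record
            { isSemigroup = record
              { isMagma = record { isEquivalence = ≈-isEquivalence ; ∙-cong = ⊕-cong }
              ; assoc = λ f g h → mk λ k → Bool.xor-assoc (f k) (g k) (h k) }
            ; identity = (λ f → ≈-refl) , (λ f → mk λ k → Bool.xor-identityʳ (f k)) }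
          ; inverse = (λ f → mk λ k → Bool.xor-same (f k)) , (λ f → mk λ k → Bool.xor-same (f k))
          ; ⁻¹-cong = λ p → p }
        ; comm = λ f g → mk λ k → Bool.xor-comm (f k) (g k) }
      ; *-cong = ⊗-cong
      ; *-assoc = λ f g h → mk (⊗-assoc f g h)
      ; *-identity = (λ f → mk (constant-⊗ true f))
                   , (λ f → mk λ k → trans (⊗-comm f 𝟙 k) (constant-⊗ true f k))
      ; distrib = (λ f g h → mk λ k → trans (⊗-comm f (g ⊕ h) k)
                     (trans (⊗-distribʳ f g h k) (cong₂ _xor_ (⊗-comm g f k) (⊗-comm h f k))))
                , (λ f g h → mk (⊗-distribʳ f g h)) }
    ; *-comm = λ f g → mk (⊗-comm f g) } }

-- Taking coefficients in 𝔽₂ lets the solver use characteristic 2.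
constant-homomorphism : CommutativeRing.rawRing Bool.xor-∧-commutativeRing
                        -Raw-AlmostCommutative⟶ fromCommutativeRing series₂
constant-homomorphism = record
  { ⟦_⟧    = constant
  ; +-homo = λ b c → mk λ { zero → refl ; (suc k) → refl }
  ; *-homo = λ b c → mk λ { zero → refl
                           ; (suc k) → sym (trans (constant-⊗ b (constant c) (suc k)) (Bool.∧-zeroʳ b)) }
  ; -‿homo = λ b → ≈-refl
  ; 0-homo = mk λ { zero → refl ; (suc k) → refl }
  ; 1-homo = ≈-refl }

constant-≟ : WeaklyDecidable (Induced-equivalence constant-homomorphism)
constant-≟ b c = Maybe.map (λ { refl → ≈-refl }) (dec⇒maybe (b Bool.≟ c))

module S = RingSolver _ _ constant-homomorphism constant-≟
open S using (_:+_; _:*_; _:=_; con; Polynomial) renaming (solve to solve₂)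

-- Squares, shifts and monomials

pow₂ : Series₂ → ℕ → Series₂
pow₂ f zero    = 𝟙
pow₂ f (suc e) = f ⊗ pow₂ f e

infixr 9 _:^_
_:^_ : ∀ {n} → Polynomial n → ℕ → Polynomial n
p :^ zero  = con true
p :^ suc e = p :* p :^ e

pow₂-cong : ∀ {f g} e → f ≈ g → pow₂ f e ≈ pow₂ g e
pow₂-cong zero    p = ≈-refl
pow₂-cong (suc e) p = ⊗-cong p (pow₂-cong e p)

-- The two cross terms f(0) f(k + 2) cancel in characteristic 2. Iterating this shows that squaring
-- substitutes q² for q.
square-suc² : ∀ f k → (f ⊗ f) (2 + k) ≡ (tail f ⊗ tail f) k
square-suc² f k = trans (cong ((f 0 ∧ f (2 + k)) xor_) (⊗-sucʳ (tail f) f k))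
  (solveBool 3 (λ a b c → a B.:* b B.:+ (b B.:* a B.:+ c) B.:= c) refl (f 0) (f (2 + k)) _)

square-even : ∀ f k → (f ⊗ f) (2 * k) ≡ f k
square-even f zero    = Bool.∧-idem (f 0)
square-even f (suc k) rewrite ℕ.+-suc k (k + 0) = trans (square-suc² f (2 * k)) (square-even (tail f) k)

square-odd : ∀ f k → (f ⊗ f) (suc (2 * k)) ≡ false
square-odd f zero    = trans (cong ((f 0 ∧ f 1) xor_) (Bool.∧-comm (f 1) (f 0))) (Bool.xor-same (f 0 ∧ f 1))
square-odd f (suc k) rewrite ℕ.+-suc k (k + 0) = trans (square-suc² f (suc (2 * k))) (square-odd (tail f) k)

shift : Series₂ → Series₂
shift f zero    = false
shift f (suc k) = f k

shift-⊗ : ∀ f g → shift f ⊗ g ≈ shift (f ⊗ g)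
shift-⊗ f g = mk λ { zero → refl ; (suc k) → refl }

shift-cong : ∀ {f g} → f ≈ g → shift f ≈ shift g
shift-cong p = mk λ { zero → refl ; (suc k) → coeff p k }

shift-cong[] : ∀ {f g n} → f ≈[ n ] g → shift f ≈[ suc n ] shift g
shift-cong[] p = mk λ { zero _ → refl ; (suc k) (s≤s k≤n) → coeff≤ p k k≤n }

mono : ℕ → Series₂
mono a k = k ≡ᵇ a

mono-zero : mono 0 ≈ 𝟙
mono-zero = mk λ { zero → refl ; (suc k) → refl }

mono-suc : ∀ a → mono (suc a) ≈ shift (mono a)
mono-suc a = mk λ { zero → refl ; (suc k) → refl }

open CommutativeRing series₂ using ()
  renaming (*-identityˡ to ⊗-identityˡ; *-identityʳ to ⊗-identityʳ; setoid to ≈-setoid)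

mono-zero-⊗ : ∀ f → mono 0 ⊗ f ≈ f
mono-zero-⊗ f = ≈-trans (⊗-cong mono-zero ≈-refl) (⊗-identityˡ f)

mono-suc-⊗ : ∀ a f → mono (suc a) ⊗ f ≈ shift (mono a ⊗ f)
mono-suc-⊗ a f = ≈-trans (⊗-cong (mono-suc a) ≈-refl) (shift-⊗ (mono a) f)

mono-+ : ∀ a b → mono (a + b) ≈ mono a ⊗ mono b
mono-+ zero    b = ≈-sym (mono-zero-⊗ (mono b))
mono-+ (suc a) b = ≈-trans (mono-suc (a + b))
  (≈-trans (shift-cong (mono-+ a b)) (≈-sym (mono-suc-⊗ a (mono b))))

-- The factor q^a gains a degrees of accuracy. In `term-limit` this makes up for the accuracy lost
-- when ∣k∣ is large.
mono-⊗-cong[] : ∀ a {f g n} → f ≈[ n ] g → mono a ⊗ f ≈[ a + n ] mono a ⊗ g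
mono-⊗-cong[] zero    {f} {g} p = ≈[]-trans (≈⇒≈[] (mono-zero-⊗ f)) (≈[]-trans p (≈⇒≈[] (≈-sym (mono-zero-⊗ g))))
mono-⊗-cong[] (suc a) {f} {g} p = ≈[]-trans (≈⇒≈[] (mono-suc-⊗ a f))
  (≈[]-trans (shift-cong[] (mono-⊗-cong[] a p)) (≈⇒≈[] (≈-sym (mono-suc-⊗ a g))))

mono-⊗-coeff-< : ∀ a f k → k < a → (mono a ⊗ f) k ≡ false
mono-⊗-coeff-< (suc a) f zero    _         = refl
mono-⊗-coeff-< (suc a) f (suc k) (s≤s k<a) = trans (coeff (mono-suc-⊗ a f) (suc k)) (mono-⊗-coeff-< a f k k<a)

mono-⊗-coeff-+ : ∀ a f k → (mono a ⊗ f) (a + k) ≡ f k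
mono-⊗-coeff-+ zero    f k = coeff (mono-zero-⊗ f) k
mono-⊗-coeff-+ (suc a) f k = trans (coeff (mono-suc-⊗ a f) (suc (a + k))) (mono-⊗-coeff-+ a f k)

mono-≡ : ∀ {a b} → a ≡ b → mono a ≈ mono b
mono-≡ refl = ≈-refl

binomial : ℕ → Series₂
binomial m = 𝟙 ⊕ mono m

binomial-≡ : ∀ {a b} → a ≡ b → binomial a ≈ binomial b
binomial-≡ refl = ≈-refl

binomial-≈[]𝟙 : ∀ {n m} → n < m → binomial m ≈[ n ] 𝟙
binomial-≈[]𝟙 {n} {m} n<m = mk λ k k≤n →
  trans (cong (𝟙 k xor_) (k≢ᵇm k (ℕ.≤-<-trans k≤n n<m))) (Bool.xor-identityʳ (𝟙 k))
  where
  k≢ᵇm : ∀ k → k < m → (k ≡ᵇ m) ≡ false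
  k≢ᵇm k k<m with k ≡ᵇ m in eq
  ... | false = refl
  ... | true  = contradiction (ℕ.≡ᵇ⇒≡ k m (subst T (sym eq) _)) (ℕ.<⇒≢ k<m)

binomial-double : ∀ m → binomial (2 * m) ≈ pow₂ (binomial m) 2
binomial-double m = ≈-trans
  (⊕-cong {𝟙} ≈-refl (≈-trans (mono-≡ (cong (λ x → m + x) (ℕ.+-identityʳ m))) (mono-+ m m)))
  (solve₂ 1 (λ x → con true :+ x :* x := (con true :+ x) :^ 2) ≈-refl (mono m))

geometric : ℕ → Series₂
geometric m k = ⌊ m ∣? k ⌋

geometric-≡ : ∀ m {a b} → (m ∣ⁿ a → m ∣ⁿ b) → (m ∣ⁿ b → m ∣ⁿ a) → geometric m a ≡ geometric m b
geometric-≡ m {a} {b} f g with m ∣? a | m ∣? b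
... | yes _ | yes _ = refl
... | no _  | no _  = refl
... | yes p | no ¬q = contradiction (f p) ¬q
... | no ¬p | yes q = contradiction (g q) ¬p

geometric-< : ∀ {m} k → k < m → geometric m k ≡ 𝟙 k
geometric-< {m} zero k<m with m ∣? 0
... | yes _ = refl
... | no ¬p = contradiction (m ∣0) ¬p
geometric-< {m} (suc k) k<m with m ∣? suc k
... | yes p = contradiction k<m (ℕ.≤⇒≯ (∣⇒≤ p))
... | no _  = refl

-- `geometric m` is periodic with period m, so from degree m on the shifted and the unshifted copy
-- cancel; below m only the constant term is present.
binomial-geometric : ∀ m → 1 ≤ m → binomial m ⊗ geometric m ≈ 𝟙
binomial-geometric m 1≤m = ≈-trans
  (solve₂ 2 (λ x g → (con true :+ x) :* g := x :* g :+ g) ≈-refl (mono m) (geometric m)) (mk go)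
  where
  go : ∀ k → (mono m ⊗ geometric m) k xor geometric m k ≡ 𝟙 k
  go k with k ℕ.<? m
  ... | yes k<m = cong₂ _xor_ (mono-⊗-coeff-< m _ k k<m) (geometric-< k k<m)
  ... | no k≮m with ℕ.m≤n⇒∃[o]m+o≡n (ℕ.≮⇒≥ k≮m)
  ...   | j , refl = trans
    (cong₂ _xor_ (mono-⊗-coeff-+ m _ j) (geometric-≡ m {m + j} {j} (λ p → ∣m+n∣m⇒∣n p ∣-refl) (∣m∣n⇒∣m+n ∣-refl)))
    (trans (Bool.xor-same (geometric m j)) (sym (𝟙-pos 1≤m)))
    where
    𝟙-pos : ∀ {n} → 1 ≤ n → 𝟙 (n + j) ≡ false
    𝟙-pos (s≤s _) = refl

-- Infinite products

prod : (ℕ → Series₂) → ℕ → Series₂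
prod F zero    = 𝟙
prod F (suc n) = prod F n ⊗ F n

-- Meaningful for Admissible F only: then the factors from the k-th on do not affect degree k.
∏∞ : (ℕ → Series₂) → Series₂
∏∞ F k = prod F k k

Admissible : (ℕ → Series₂) → Set
Admissible F = ∀ n → F n ≈[ n ] 𝟙

prod-cong : ∀ {F G} → (∀ n → F n ≈ G n) → ∀ n → prod F n ≈ prod G n
prod-cong p zero    = ≈-refl
prod-cong p (suc n) = ⊗-cong (prod-cong p n) (p n)

prod-⊗ : ∀ F G n → prod (λ i → F i ⊗ G i) n ≈ prod F n ⊗ prod G n
prod-⊗ F G zero    = ≈-sym (⊗-identityˡ 𝟙)
prod-⊗ F G (suc n) = ≈-trans (⊗-cong (prod-⊗ F G n) ≈-refl)
  (solve₂ 4 (λ a b c d → a :* b :* (c :* d) := a :* c :* (b :* d)) ≈-refl (prod F n) (prod G n) (F n) (G n))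

prod-𝟙 : ∀ n → prod (λ _ → 𝟙) n ≈ 𝟙
prod-𝟙 zero    = ≈-refl
prod-𝟙 (suc n) = ≈-trans (⊗-identityʳ _) (prod-𝟙 n)

prod-stable : ∀ {F} → Admissible F → ∀ {m n} → m ≤ n → prod F n ≈[ m ] prod F m
prod-stable {F} adm {m} m≤n = go (ℕ.≤⇒≤′ m≤n)
  where
  go : ∀ {n} → m ℕ.≤′ n → prod F n ≈[ m ] prod F m
  go ℕ.≤′-refl = ≈⇒≈[] ≈-refl
  go (ℕ.≤′-step {n} m≤′n) = ≈[]-trans
    (⊗-cong[] (go m≤′n) (≈[]-weaken (ℕ.≤′⇒≤ m≤′n) (adm n))) (≈⇒≈[] (⊗-identityʳ _))

prod-≈[]-∏∞ : ∀ {F} → Admissible F → ∀ {m n} → m ≤ n → prod F n ≈[ m ] ∏∞ F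
prod-≈[]-∏∞ adm m≤n = mk λ k k≤m → coeff≤ (prod-stable adm (ℕ.≤-trans k≤m m≤n)) k ℕ.≤-refl

∏∞-cong : ∀ {F G} → (∀ n → F n ≈ G n) → ∏∞ F ≈ ∏∞ G
∏∞-cong p = mk λ k → coeff (prod-cong p k) k

∏∞-⊗ : ∀ {F G} → Admissible F → Admissible G → ∏∞ (λ n → F n ⊗ G n) ≈ ∏∞ F ⊗ ∏∞ G
∏∞-⊗ {F} {G} admF admG = mk λ k → trans (coeff (prod-⊗ F G k) k)
  (coeff≤ (⊗-cong[] (prod-≈[]-∏∞ admF ℕ.≤-refl) (prod-≈[]-∏∞ admG ℕ.≤-refl)) k ℕ.≤-refl)

∏∞-𝟙 : ∏∞ (λ _ → 𝟙) ≈ 𝟙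
∏∞-𝟙 = mk λ k → coeff (prod-𝟙 k) k

⊗-≈[]𝟙 : ∀ {f g n} → f ≈[ n ] 𝟙 → g ≈[ n ] 𝟙 → f ⊗ g ≈[ n ] 𝟙
⊗-≈[]𝟙 p q = ≈[]-trans (⊗-cong[] p q) (≈⇒≈[] (⊗-identityˡ 𝟙))

pow₂-≈[]𝟙 : ∀ {f n} e → f ≈[ n ] 𝟙 → pow₂ f e ≈[ n ] 𝟙
pow₂-≈[]𝟙 zero    p = ≈⇒≈[] ≈-refl
pow₂-≈[]𝟙 (suc e) p = ⊗-≈[]𝟙 p (pow₂-≈[]𝟙 e p)

∏∞-pow₂ : ∀ {F} e → Admissible F → ∏∞ (λ n → pow₂ (F n) e) ≈ pow₂ (∏∞ F) e
∏∞-pow₂ zero    adm = ∏∞-𝟙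
∏∞-pow₂ (suc e) adm = ≈-trans (∏∞-⊗ adm (λ n → pow₂-≈[]𝟙 e (adm n))) (⊗-cong ≈-refl (∏∞-pow₂ e adm))

-- Euler products, their inverses and doubling of the level

euler euler⁻¹ : ℕ → Series₂
euler   d = ∏∞ (λ n → binomial  (d * suc n))
euler⁻¹ d = ∏∞ (λ n → geometric (d * suc n))

n<d*[1+n] : ∀ d n → 1 ≤ d → n < d * suc n
n<d*[1+n] d@(suc _) n _ = ℕ.m≤n*m (suc n) d

binomial-admissible : ∀ d → 1 ≤ d → Admissible (λ n → binomial (d * suc n))
binomial-admissible d 1≤d n = binomial-≈[]𝟙 (n<d*[1+n] d n 1≤d)

geometric-admissible : ∀ d → 1 ≤ d → Admissible (λ n → geometric (d * suc n))
geometric-admissible d 1≤d n = mk λ k k≤n → geometric-< k (ℕ.≤-<-trans k≤n (n<d*[1+n] d n 1≤d))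

1≤d*[1+n] : ∀ d n → 1 ≤ d → 1 ≤ d * suc n
1≤d*[1+n] d n 1≤d = ℕ.≤-trans (s≤s z≤n) (n<d*[1+n] d n 1≤d)

euler-inverse : ∀ d → 1 ≤ d → euler d ⊗ euler⁻¹ d ≈ 𝟙
euler-inverse d 1≤d = ≈-trans
  (≈-sym (∏∞-⊗ (binomial-admissible d 1≤d) (geometric-admissible d 1≤d)))
  (≈-trans (∏∞-cong (λ n → binomial-geometric (d * suc n) (1≤d*[1+n] d n 1≤d))) ∏∞-𝟙)

euler-double : ∀ d → 1 ≤ d → euler (2 * d) ≈ pow₂ (euler d) 2
euler-double d 1≤d = ≈-trans
  (∏∞-cong λ n → ≈-trans (binomial-≡ (ℕ.*-assoc 2 d (suc n))) (binomial-double (d * suc n)))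
  (∏∞-pow₂ 2 (binomial-admissible d 1≤d))

inverse-unique : ∀ {f g h} → f ⊗ g ≈ 𝟙 → f ⊗ h ≈ 𝟙 → g ≈ h
inverse-unique {f} {g} {h} p q = begin
  g            ≈⟨ ⊗-identityʳ g ⟨
  g ⊗ 𝟙        ≈⟨ ⊗-cong ≈-refl q ⟨
  g ⊗ (f ⊗ h)  ≈⟨ solve₂ 3 (λ f g h → g :* (f :* h) := f :* g :* h) ≈-refl f g h ⟩
  f ⊗ g ⊗ h    ≈⟨ ⊗-cong p ≈-refl ⟩
  𝟙 ⊗ h        ≈⟨ ⊗-identityˡ h ⟩
  h            ∎
  where open SetoidReasoning ≈-setoid

euler⁻¹-double : ∀ d → 1 ≤ d → euler⁻¹ (2 * d) ≈ pow₂ (euler⁻¹ d) 2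
euler⁻¹-double d 1≤d = inverse-unique (euler-inverse (2 * d) (ℕ.≤-trans 1≤d (ℕ.m≤m+n d _))) (begin
  euler (2 * d) ⊗ pow₂ (euler⁻¹ d) 2    ≈⟨ ⊗-cong (euler-double d 1≤d) ≈-refl ⟩
  pow₂ (euler d) 2 ⊗ pow₂ (euler⁻¹ d) 2
    ≈⟨ solve₂ 2 (λ x y → x :^ 2 :* y :^ 2 := (x :* y) :^ 2) ≈-refl (euler d) (euler⁻¹ d) ⟩
  pow₂ (euler d ⊗ euler⁻¹ d) 2          ≈⟨ pow₂-cong 2 (euler-inverse d 1≤d) ⟩
  pow₂ 𝟙 2                              ≈⟨ solve₂ 0 (con true :^ 2 := con true) ≈-refl ⟩
  𝟙                                     ∎)
  where open SetoidReasoning ≈-setoid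

-- Reduction modulo 2

parityℕ : ℕ → Bool
parityℕ zero    = false
parityℕ (suc n) = true xor parityℕ n

parity : ℤ → Bool
parity i = parityℕ ∣ i ∣

parityℕ-+ : ∀ m n → parityℕ (m + n) ≡ parityℕ m xor parityℕ n
parityℕ-+ zero    n = refl
parityℕ-+ (suc m) n = trans (cong (true xor_) (parityℕ-+ m n)) (sym (Bool.xor-assoc true (parityℕ m) (parityℕ n)))

parityℕ-* : ∀ m n → parityℕ (m * n) ≡ parityℕ m ∧ parityℕ n
parityℕ-* zero    n = refl
parityℕ-* (suc m) n = trans (parityℕ-+ n (m * n)) (trans (cong (parityℕ n xor_) (parityℕ-* m n))
  (sym (Bool.∧-distribʳ-xor (parityℕ n) true (parityℕ m))))

parity-⊖ : ∀ m n → parity (m ⊖ n) ≡ parityℕ m xor parityℕ n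
parity-⊖ zero    zero    = refl
parity-⊖ zero    (suc n) = refl
parity-⊖ (suc m) zero    = sym (Bool.xor-identityʳ _)
parity-⊖ (suc m) (suc n) = trans (cong parity (ℤ.[1+m]⊖[1+n]≡m⊖n m n)) (trans (parity-⊖ m n)
  (solveBool 2 (λ a b → a B.:+ b B.:= (B.con true B.:+ a) B.:+ (B.con true B.:+ b)) refl (parityℕ m) (parityℕ n)))

parity-+ : ∀ i j → parity (i ℤ.+ j) ≡ parity i xor parity j
parity-+ (+ m)    (+ n)    = parityℕ-+ m n
parity-+ (+ m)    -[1+ n ] = parity-⊖ m (suc n)
parity-+ -[1+ m ] (+ n)    = trans (parity-⊖ n (suc m)) (Bool.xor-comm (parityℕ n) _)
parity-+ -[1+ m ] -[1+ n ] = trans (cong (λ x → parityℕ (suc x)) (sym (ℕ.+-suc m n))) (parityℕ-+ (suc m) (suc n))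

parity-* : ∀ i j → parity (i ℤ.* j) ≡ parity i ∧ parity j
parity-* i j = trans (cong parityℕ (ℤ.abs-* i j)) (parityℕ-* ∣ i ∣ ∣ j ∣)

2∣⇐parityℕ : ∀ n → parityℕ n ≡ false → 2 ∣ⁿ n
2∣⇐parityℕ zero          _ = 2 ∣0
2∣⇐parityℕ (suc (suc n)) p = ∣m∣n⇒∣m+n (∣-refl {2}) (2∣⇐parityℕ n (trans (double-xor (parityℕ n)) p))
  where
  double-xor : ∀ b → b ≡ true xor (true xor b)
  double-xor true  = refl
  double-xor false = refl

2∣⇐parity : ∀ i → parity i ≡ false → + 2 ∣ i
2∣⇐parity i = 2∣⇐parityℕ ∣ i ∣

reduce : Series → Series₂
reduce f k = parity (f k)

-- `sumTo` peels off its last summand, `_⊗_` its first; this reconciles the two recursions.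
sumTo-suc : ∀ f k → sumTo f (suc k) ≡ f 0 ℤ.+ sumTo (λ i → f (suc i)) k
sumTo-suc f zero    = refl
sumTo-suc f (suc k) = trans (cong (ℤ._+ f (2 + k)) (sumTo-suc f k)) (ℤ.+-assoc (f 0) _ _)

reduce-⊛ : ∀ f g → reduce (f ⊛ g) ≈ reduce f ⊗ reduce g
reduce-⊛ f g = mk (go f)
  where
  go : ∀ f k → parity ((f ⊛ g) k) ≡ (reduce f ⊗ reduce g) k
  go f zero    = parity-* (f 0) (g 0)
  go f (suc k) = trans (cong parity (sumTo-suc (λ i → f i ℤ.* g (suc k ∸ i)) k))
    (trans (parity-+ (f 0 ℤ.* g (suc k)) _) (cong₂ _xor_ (parity-* (f 0) (g (suc k))) (go (λ i → f (suc i)) k)))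

reduce-one : reduce one ≈ 𝟙
reduce-one = mk λ { zero → refl ; (suc k) → refl }

reduce-pow : ∀ f e → reduce (pow f e) ≈ pow₂ (reduce f) e
reduce-pow f zero    = reduce-one
reduce-pow f (suc e) = ≈-trans (reduce-⊛ f (pow f e)) (⊗-cong ≈-refl (reduce-pow f e))

reduce-oneMinus : ∀ m → 1 ≤ m → reduce (oneMinus m) ≈ binomial m
reduce-oneMinus (suc m) _ = mk λ { zero → refl ; (suc k) → go k }
  where
  go : ∀ k → parity (oneMinus (suc m) (suc k)) ≡ binomial (suc m) (suc k)
  go k with k ≡ᵇ m
  ... | true  = refl
  ... | false = refl

reduce-geom : ∀ m → reduce (geom m) ≈ geometric m
reduce-geom m = mk go
  where
  go : ∀ k → parity (geom m k) ≡ geometric m k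
  go k with m ∣? k
  ... | yes _ = refl
  ... | no _  = refl

factor₂ : ℕ → ℤ → Series₂
factor₂ m (+ e)    = pow₂ (binomial m) e
factor₂ m -[1+ e ] = pow₂ (geometric m) (suc e)

reduce-factor : ∀ m r → 1 ≤ m → reduce (factor m r) ≈ factor₂ m r
reduce-factor m (+ e)    1≤m = ≈-trans (reduce-pow (oneMinus m) e) (pow₂-cong e (reduce-oneMinus m 1≤m))
reduce-factor m -[1+ e ] 1≤m = ≈-trans (reduce-pow (geom m) (suc e)) (pow₂-cong (suc e) (reduce-geom m))

factorProduct₂ : List (ℕ × ℤ) → ℕ → Series₂
factorProduct₂ []             n = 𝟙
factorProduct₂ ((d , r) ∷ ds) n = factor₂ (d * suc n) r ⊗ factorProduct₂ ds n

etaProduct₂ : List (ℕ × ℤ) → Series₂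
etaProduct₂ []                    = 𝟙
etaProduct₂ ((d , + e)      ∷ ds) = pow₂ (euler d) e ⊗ etaProduct₂ ds
etaProduct₂ ((d , -[1+ e ]) ∷ ds) = pow₂ (euler⁻¹ d) (suc e) ⊗ etaProduct₂ ds

PositiveLevels : List (ℕ × ℤ) → Set
PositiveLevels = All (λ dr → 1 ≤ proj₁ dr)

factor₂-admissible : ∀ d r → 1 ≤ d → Admissible (λ n → factor₂ (d * suc n) r)
factor₂-admissible d (+ e)    1≤d n = pow₂-≈[]𝟙 e (binomial-admissible d 1≤d n)
factor₂-admissible d -[1+ e ] 1≤d n = pow₂-≈[]𝟙 (suc e) (geometric-admissible d 1≤d n)

factorProduct₂-admissible : ∀ {ds} → PositiveLevels ds → Admissible (factorProduct₂ ds)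
factorProduct₂-admissible []                  n = ≈⇒≈[] ≈-refl
factorProduct₂-admissible {(d , r) ∷ _} (1≤d ∷ ps) n =
  ⊗-≈[]𝟙 (factor₂-admissible d r 1≤d n) (factorProduct₂-admissible ps n)

∏∞-factorProduct₂ : ∀ {ds} → PositiveLevels ds → ∏∞ (factorProduct₂ ds) ≈ etaProduct₂ ds
∏∞-factorProduct₂ [] = ∏∞-𝟙
∏∞-factorProduct₂ {(d , r) ∷ ds} (1≤d ∷ ps) = ≈-trans
  (∏∞-⊗ (factor₂-admissible d r 1≤d) (factorProduct₂-admissible ps)) (go r)
  where
  go : ∀ r → ∏∞ (λ n → factor₂ (d * suc n) r) ⊗ ∏∞ (factorProduct₂ ds) ≈ etaProduct₂ ((d , r) ∷ ds)
  go (+ e)    = ⊗-cong (∏∞-pow₂ e (binomial-admissible d 1≤d)) (∏∞-factorProduct₂ ps)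
  go -[1+ e ] = ⊗-cong (∏∞-pow₂ (suc e) (geometric-admissible d 1≤d)) (∏∞-factorProduct₂ ps)

-- The step function of Defs is an anonymous pattern-matching λ, so it is abstracted to f here.
reduce-foldr : ∀ n f → (∀ d r acc → f (d , r) acc ≡ factor (d * suc n) r ⊛ acc) →
               ∀ {ds} → PositiveLevels ds → reduce (foldr f one ds) ≈ factorProduct₂ ds n
reduce-foldr n f eq []       = reduce-one
reduce-foldr n f eq {(d , r) ∷ ds} (1≤d ∷ ps) rewrite eq d r (foldr f one ds) = ≈-trans
  (reduce-⊛ (factor (d * suc n) r) (foldr f one ds))
  (⊗-cong (reduce-factor (d * suc n) r (1≤d*[1+n] d n 1≤d)) (reduce-foldr n f eq ps))

reduce-etaProdUpTo : ∀ {ds} → PositiveLevels ds → ∀ n → reduce (etaProdUpTo ds n) ≈ prod (factorProduct₂ ds) n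
reduce-etaProdUpTo      ps zero    = reduce-one
reduce-etaProdUpTo {ds} ps (suc n) = extend _ (λ _ _ _ → refl)
  where
  extend : ∀ f → (∀ d r acc → f (d , r) acc ≡ factor (d * suc n) r ⊛ acc) →
           reduce (etaProdUpTo ds n ⊛ foldr f one ds) ≈ prod (factorProduct₂ ds) (suc n)
  extend f eq = ≈-trans (reduce-⊛ (etaProdUpTo ds n) (foldr f one ds))
    (⊗-cong (reduce-etaProdUpTo ps n) (reduce-foldr n f eq ps))

-- `etaProdCoeff` and `∏∞` both read degree k off the first k factors, so they match degree by
-- degree with no limit to take.
reduce-etaProdCoeff : ∀ {ds} → PositiveLevels ds → reduce (etaProdCoeff ds) ≈ etaProduct₂ ds
reduce-etaProdCoeff ps = ≈-trans (mk λ k → coeff (reduce-etaProdUpTo ps k) k) (∏∞-factorProduct₂ ps)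

-- Fourth powers and part (b)

pow₂-4-coeff : ∀ f k r → 1 ≤ r → r < 4 → pow₂ f 4 (4 * k + r) ≡ false
pow₂-4-coeff f k r 1≤r r<4 = trans (coeff pow₂-4 (4 * k + r)) (go r 1≤r r<4)
  where
  pow₂-4 : pow₂ f 4 ≈ (f ⊗ f) ⊗ (f ⊗ f)
  pow₂-4 = solve₂ 1 (λ x → x :^ 4 := x :* x :* (x :* x)) ≈-refl f
  -- As the square of a square, the series has no odd degrees, and degree 4k + 2 comes from the odd
  -- degree 2k + 1 of f².
  go : ∀ r → 1 ≤ r → r < 4 → ((f ⊗ f) ⊗ (f ⊗ f)) (4 * k + r) ≡ false
  go 1 _ _ = trans (cong ((f ⊗ f) ⊗ (f ⊗ f)) (solveℕ 1 (λ k → N.con 4 N.:* k N.:+ N.con 1 N.:= N.con 1 N.:+ N.con 2 N.:* (N.con 2 N.:* k)) refl k))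
                   (square-odd (f ⊗ f) (2 * k))
  go 2 _ _ = trans (cong ((f ⊗ f) ⊗ (f ⊗ f)) (solveℕ 1 (λ k → N.con 4 N.:* k N.:+ N.con 2 N.:= N.con 2 N.:* (N.con 1 N.:+ N.con 2 N.:* k)) refl k))
                   (trans (square-even (f ⊗ f) (suc (2 * k))) (square-odd f k))
  go 3 _ _ = trans (cong ((f ⊗ f) ⊗ (f ⊗ f)) (solveℕ 1 (λ k → N.con 4 N.:* k N.:+ N.con 3 N.:= N.con 1 N.:+ N.con 2 N.:* (N.con 1 N.:+ N.con 2 N.:* k)) refl k))
                   (square-odd (f ⊗ f) (suc (2 * k)))
  go (suc (suc (suc (suc _)))) _ (s≤s (s≤s (s≤s (s≤s ()))))

-- The expansion starts at q⁻¹, so index m belongs to degree m + 1 of the product: the residues 0,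
-- 1, 2 become 1, 2, 3, exactly those absent from a fourth power. The other eta quotient carries the
-- even factor 16.
J10*-even : ∀ n → 1 ≤ n → ∀ r → r < 3 → parity (J10* (4 * n + r)) ≡ false
J10*-even (suc n) _ r r<3 = go (4 * n + r) (cong (_+ r) (ℕ.*-suc 4 n))
  where
  positive : PositiveLevels PExps
  positive = s≤s z≤n ∷ s≤s z≤n ∷ s≤s z≤n ∷ s≤s z≤n ∷ []
  root : Series₂
  root = euler 1 ⊗ euler 5 ⊗ euler⁻¹ 2 ⊗ euler⁻¹ 10
  fourth-power : reduce (etaProdCoeff PExps) ≈ pow₂ root 4
  fourth-power = ≈-trans (reduce-etaProdCoeff positive)
    (solve₂ 4 (λ a b c d → a :^ 4 :* (b :^ 4 :* (c :^ 4 :* (d :^ 4 :* con true))) := (a :* b :* c :* d) :^ 4)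
      ≈-refl (euler 1) (euler 5) (euler⁻¹ 2) (euler⁻¹ 10))
  -- The form 4 + m exposes the successor on which `J10*` matches; its constant term 4 enters only
  -- at index 0.
  go : ∀ m → 4 * suc n + r ≡ 4 + m → parity (J10* (4 * suc n + r)) ≡ false
  go m eq = trans (cong (λ x → parity (J10* x)) eq)
    (trans (parity-+ (etaProdCoeff PExps (5 + m)) (+ 16 ℤ.* etaProdCoeff QExps (3 + m)))
      (cong₂ _xor_
        (trans (coeff fourth-power (5 + m)) (trans (cong (pow₂ root 4) index) (pow₂-4-coeff root (suc n) (suc r) (s≤s z≤n) (s≤s r<3))))
        (parity-* (+ 16) (etaProdCoeff QExps (3 + m)))))
    where
    index : 5 + m ≡ 4 * suc n + suc r
    index = sym (trans (ℕ.+-suc (4 * suc n) r) (cong suc eq))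

-- The Jacobi triple product

∑ : {X : Set} → List X → (X → Bool) → Bool
∑ []       g = false
∑ (x ∷ xs) g = g x xor ∑ xs g

∑-cong : ∀ {X : Set} (xs : List X) {g h : X → Bool} → (∀ x → x ∈ xs → g x ≡ h x) → ∑ xs g ≡ ∑ xs h
∑-cong []       p = refl
∑-cong (x ∷ xs) p = cong₂ _xor_ (p x (here refl)) (∑-cong xs (λ y y∈ → p y (there y∈)))

∑-xor : ∀ {X : Set} (xs : List X) (g h : X → Bool) → ∑ xs (λ x → g x xor h x) ≡ ∑ xs g xor ∑ xs h
∑-xor []       g h = refl
∑-xor (x ∷ xs) g h = trans (cong ((g x xor h x) xor_) (∑-xor xs g h)) (xor-interchange (g x) (h x) _ _)

∑ˢ : {X : Set} → List X → (X → Series₂) → Series₂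
∑ˢ xs t k = ∑ xs (λ x → t x k)

∑ˢ-cong : ∀ {X : Set} (xs : List X) {t u : X → Series₂} → (∀ x → x ∈ xs → t x ≈ u x) → ∑ˢ xs t ≈ ∑ˢ xs u
∑ˢ-cong xs p = mk λ k → ∑-cong xs (λ x x∈ → coeff (p x x∈) k)

∑ˢ-cong[] : ∀ {X : Set} {n} (xs : List X) {t u : X → Series₂} →
            (∀ x → x ∈ xs → t x ≈[ n ] u x) → ∑ˢ xs t ≈[ n ] ∑ˢ xs u
∑ˢ-cong[] xs p = mk λ k k≤n → ∑-cong xs (λ x x∈ → coeff≤ (p x x∈) k k≤n)

∑ˢ-⊕ : ∀ {X : Set} (xs : List X) (t u : X → Series₂) → ∑ˢ xs (λ x → t x ⊕ u x) ≈ ∑ˢ xs t ⊕ ∑ˢ xs u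
∑ˢ-⊕ xs t u = mk λ k → ∑-xor xs (λ x → t x k) (λ x → u x k)

⊗-∑ˢ : ∀ {X : Set} f (xs : List X) (t : X → Series₂) → f ⊗ ∑ˢ xs t ≈ ∑ˢ xs (λ x → f ⊗ t x)
⊗-∑ˢ f []       t = mk λ k → trans (⊗-comm f 𝟘 k) (⊗-zeroˡ f k)
⊗-∑ˢ f (x ∷ xs) t = ≈-trans
  (solve₂ 3 (λ f a b → f :* (a :+ b) := f :* a :+ f :* b) ≈-refl f (t x) (∑ˢ xs t))
  (⊕-cong {f ⊗ t x} ≈-refl (⊗-∑ˢ f xs t))

interval : ℕ → List ℤ
interval zero    = + 0 ∷ []
interval (suc n) = + suc n ∷ -[1+ n ] ∷ interval n

∈-interval⁻ : ∀ {n k} → k ∈ interval n → ∣ k ∣ ≤ n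
∈-interval⁻ {zero}  (here refl)         = z≤n
∈-interval⁻ {suc n} (here refl)         = ℕ.≤-refl
∈-interval⁻ {suc n} (there (here refl)) = ℕ.≤-refl
∈-interval⁻ {suc n} (there (there k∈))  = ℕ.m≤n⇒m≤1+n (∈-interval⁻ k∈)

∈-interval⁺ : ∀ n k → ∣ k ∣ ≤ n → k ∈ interval n
∈-interval⁺ n k ∣k∣≤n = go k (ℕ.≤⇒≤′ ∣k∣≤n)
  where
  self : ∀ k → k ∈ interval ∣ k ∣
  self (+ zero)  = here refl
  self (+ suc n) = here refl
  self -[1+ n ]  = there (here refl)
  go : ∀ k {n} → ∣ k ∣ ℕ.≤′ n → k ∈ interval n
  go k ℕ.≤′-refl     = self k
  go k (ℕ.≤′-step p) = there (there (go k p))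

-- Both sides add up t over -n - 1, ..., n: the translated window misses n, the original one misses
-- -n - 1.
∑-interval-pred : ∀ t n → ∑ (interval n) (λ k → t (ℤ.pred k)) xor t (+ n) ≡ ∑ (interval n) t xor t -[1+ n ]
∑-interval-pred t zero    = solveBool 2 (λ a b → (a B.:+ B.con false) B.:+ b B.:= (b B.:+ B.con false) B.:+ a) refl (t -[1+ 0 ]) (t (+ 0))
∑-interval-pred t (suc n) = begin
  (t (+ n) xor (t -[1+ suc n ] xor S′)) xor t (+ suc n)
    ≡⟨ solveBool 4 (λ a b c d → (a B.:+ (b B.:+ c)) B.:+ d B.:= (c B.:+ a) B.:+ (d B.:+ b)) refl (t (+ n)) (t -[1+ suc n ]) S′ (t (+ suc n)) ⟩
  (S′ xor t (+ n)) xor (t (+ suc n) xor t -[1+ suc n ])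
    ≡⟨ cong (_xor (t (+ suc n) xor t -[1+ suc n ])) (∑-interval-pred t n) ⟩
  (S xor t -[1+ n ]) xor (t (+ suc n) xor t -[1+ suc n ])
    ≡⟨ solveBool 4 (λ c a d b → (c B.:+ a) B.:+ (d B.:+ b) B.:= (d B.:+ (a B.:+ c)) B.:+ b) refl S (t -[1+ n ]) (t (+ suc n)) (t -[1+ suc n ]) ⟩
  (t (+ suc n) xor (t -[1+ n ] xor S)) xor t -[1+ suc n ] ∎
  where
  open ≡-Reasoning
  S S′ : Bool
  S  = ∑ (interval n) t
  S′ = ∑ (interval n) (λ k → t (ℤ.pred k))

module _ {t : ℤ → Bool} {n : ℕ} (vanish : ∀ k → n < ∣ k ∣ → t k ≡ false) where

  ∑-interval-suc : ∑ (interval (suc n)) t ≡ ∑ (interval n) t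
  ∑-interval-suc = cong₂ _xor_ (vanish (+ suc n) ℕ.≤-refl)
    (cong (_xor ∑ (interval n) t) (vanish -[1+ n ] ℕ.≤-refl))

  -- A summand supported on ∣k∣ ≤ n keeps its support inside the window n + 1 after a translation by
  -- one, so the boundary terms vanish.
  ∑-interval-shiftʳ : ∑ (interval (suc n)) (λ k → t (ℤ.pred k)) ≡ ∑ (interval n) t
  ∑-interval-shiftʳ = begin
    S                           ≡⟨ Bool.xor-identityʳ S ⟨
    S xor false                 ≡⟨ cong (S xor_) (vanish (+ suc n) ℕ.≤-refl) ⟨
    S xor t (+ suc n)           ≡⟨ ∑-interval-pred t (suc n) ⟩
    ∑ (interval (suc n)) t xor t -[1+ suc n ]
                                ≡⟨ cong₂ _xor_ ∑-interval-suc (vanish -[1+ suc n ] (ℕ.m≤n⇒m≤1+n ℕ.≤-refl)) ⟩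
    ∑ (interval n) t xor false  ≡⟨ Bool.xor-identityʳ _ ⟩
    ∑ (interval n) t            ∎
    where
    open ≡-Reasoning
    S : Bool
    S = ∑ (interval (suc n)) (λ k → t (ℤ.pred k))

  ∑-interval-shiftˡ : ∑ (interval (suc n)) (λ k → t (ℤ.suc k)) ≡ ∑ (interval n) t
  ∑-interval-shiftˡ = begin
    S                                ≡⟨ Bool.xor-identityʳ S ⟨
    S xor false                      ≡⟨ cong (S xor_) (vanish -[1+ n ] ℕ.≤-refl) ⟨
    S xor t -[1+ n ]                 ≡⟨ ∑-interval-pred (λ k → t (ℤ.suc k)) (suc n) ⟨
    ∑ (interval (suc n)) (λ k → t (ℤ.suc (ℤ.pred k))) xor t (+ (2 + n))
      ≡⟨ cong₂ _xor_ (trans (∑-cong (interval (suc n)) (λ k _ → cong t (ℤ.suc-pred k))) ∑-interval-suc)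
                     (vanish (+ (2 + n)) (ℕ.m≤n⇒m≤1+n ℕ.≤-refl)) ⟩
    ∑ (interval n) t xor false       ≡⟨ Bool.xor-identityʳ _ ⟩
    ∑ (interval n) t                 ∎
    where
    open ≡-Reasoning
    S : Bool
    S = ∑ (interval (suc n)) (λ k → t (ℤ.suc k))

-- This is k(k + 1)/2 for every integer k; the recursion away from 0 and from -1 keeps it a natural
-- number without halving.
triangle : ℤ → ℕ
triangle (+ zero)      = 0
triangle (+ suc n)     = suc n + triangle (+ n)
triangle -[1+ zero ]   = 0
triangle -[1+ suc n ]  = suc n + triangle -[1+ n ]

-- Doubled exponents are polynomials over ℤ, so identities between exponents are left to the ring
-- solver and then halved by `2*-injective`.
2*triangle : ∀ k → + 2 ℤ.* + triangle k ≡ k ℤ.* (k ℤ.+ + 1)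
2*triangle (+ zero)     = refl
2*triangle (+ suc n)    = trans (cong (+ 2 ℤ.*_) (ℤ.pos-+ (suc n) (triangle (+ n))))
  (trans (ℤ.*-distribˡ-+ (+ 2) (+ suc n) (+ triangle (+ n)))
  (trans (cong (λ x → + 2 ℤ.* + suc n ℤ.+ x) (2*triangle (+ n)))
  (solveℤ 1 (λ n → Z.con (+ 2) Z.:* (Z.con (+ 1) Z.:+ n) Z.:+ n Z.:* (n Z.:+ Z.con (+ 1))
                    Z.:= (Z.con (+ 1) Z.:+ n) Z.:* (Z.con (+ 1) Z.:+ n Z.:+ Z.con (+ 1))) refl (+ n))))
2*triangle -[1+ zero ]  = refl
2*triangle -[1+ suc n ] = trans (cong (+ 2 ℤ.*_) (ℤ.pos-+ (suc n) (triangle -[1+ n ])))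
  (trans (ℤ.*-distribˡ-+ (+ 2) (+ suc n) (+ triangle -[1+ n ]))
  (trans (cong (λ x → + 2 ℤ.* + suc n ℤ.+ x) (2*triangle -[1+ n ]))
  (solveℤ 1 (λ m → Z.con (+ 2) Z.:* m Z.:+ (Z.:- m) Z.:* (Z.:- m Z.:+ Z.con (+ 1))
                    Z.:= (Z.:- (Z.con (+ 1) Z.:+ m)) Z.:* (Z.:- (Z.con (+ 1) Z.:+ m) Z.:+ Z.con (+ 1))) refl (+ suc n))))

2*-injective : ∀ {m n} → + 2 ℤ.* + m ≡ + 2 ℤ.* + n → m ≡ n
2*-injective eq = ℤ.+-injective (ℤ.*-cancelˡ-≡ (+ 2) _ _ eq)

-- `triangle (- k)` is k(k - 1)/2, so this is the k-th exponent of f(A,B).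
exponent : ℕ → ℕ → ℤ → ℕ
exponent A B k = A * triangle k + B * triangle (ℤ.- k)

2*exponent : ∀ A B k → + 2 ℤ.* + exponent A B k ≡ + A ℤ.* (k ℤ.* (k ℤ.+ + 1)) ℤ.+ + B ℤ.* (ℤ.- k ℤ.* (ℤ.- k ℤ.+ + 1))
2*exponent A B k = begin
  + 2 ℤ.* + exponent A B k
    ≡⟨ cong (+ 2 ℤ.*_) (trans (ℤ.pos-+ (A * triangle k) _) (cong₂ ℤ._+_ (ℤ.pos-* A _) (ℤ.pos-* B _))) ⟩
  + 2 ℤ.* (+ A ℤ.* + triangle k ℤ.+ + B ℤ.* + triangle (ℤ.- k))
    ≡⟨ solveℤ 4 (λ a b x y → Z.con (+ 2) Z.:* (a Z.:* x Z.:+ b Z.:* y)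
                    Z.:= a Z.:* (Z.con (+ 2) Z.:* x) Z.:+ b Z.:* (Z.con (+ 2) Z.:* y)) refl (+ A) (+ B) (+ triangle k) (+ triangle (ℤ.- k)) ⟩
  + A ℤ.* (+ 2 ℤ.* + triangle k) ℤ.+ + B ℤ.* (+ 2 ℤ.* + triangle (ℤ.- k))
    ≡⟨ cong₂ (λ x y → + A ℤ.* x ℤ.+ + B ℤ.* y) (2*triangle k) (2*triangle (ℤ.- k)) ⟩
  + A ℤ.* (k ℤ.* (k ℤ.+ + 1)) ℤ.+ + B ℤ.* (ℤ.- k ℤ.* (ℤ.- k ℤ.+ + 1)) ∎
  where open ≡-Reasoning

-- The exponent grows by (A + B)k - B from k - 1 to k. Hence the factor q^{(A+B)n+A} turns the
-- monomial of k - 1 into that of k times q^{(A+B)U}.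
exponent-pred : ∀ A B {n U k} → + U ≡ + suc n ℤ.- k → (A + B) * n + A + exponent A B (ℤ.pred k) ≡ exponent A B k + (A + B) * U
exponent-pred A B {n} {U} {k} hU = 2*-injective (begin
  + 2 ℤ.* + ((A + B) * n + A + exponent A B (ℤ.pred k))
    ≡⟨ cong (+ 2 ℤ.*_) (cong (ℤ._+ + exponent A B (ℤ.pred k)) (cong (ℤ._+ + A) (ℤ.pos-* (A + B) n))) ⟩
  + 2 ℤ.* ((+ A ℤ.+ + B) ℤ.* + n ℤ.+ + A ℤ.+ + exponent A B (ℤ.pred k))
    ≡⟨ ℤ.*-distribˡ-+ (+ 2) ((+ A ℤ.+ + B) ℤ.* + n ℤ.+ + A) _ ⟩
  + 2 ℤ.* ((+ A ℤ.+ + B) ℤ.* + n ℤ.+ + A) ℤ.+ + 2 ℤ.* + exponent A B (ℤ.pred k)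
    ≡⟨ cong (λ x → + 2 ℤ.* ((+ A ℤ.+ + B) ℤ.* + n ℤ.+ + A) ℤ.+ x) (2*exponent A B (ℤ.pred k)) ⟩
  + 2 ℤ.* ((+ A ℤ.+ + B) ℤ.* + n ℤ.+ + A) ℤ.+ (+ A ℤ.* (ℤ.pred k ℤ.* (ℤ.pred k ℤ.+ + 1)) ℤ.+ + B ℤ.* (ℤ.- ℤ.pred k ℤ.* (ℤ.- ℤ.pred k ℤ.+ + 1)))
    ≡⟨ solveℤ 4 (λ a b n k → let p = Z.con (ℤ.- + 1) Z.:+ k; i = Z.con (+ 1); d = Z.con (+ 2) in
         d Z.:* ((a Z.:+ b) Z.:* n Z.:+ a) Z.:+ (a Z.:* (p Z.:* (p Z.:+ i)) Z.:+ b Z.:* (Z.:- p Z.:* (Z.:- p Z.:+ i)))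
         Z.:= a Z.:* (k Z.:* (k Z.:+ i)) Z.:+ b Z.:* (Z.:- k Z.:* (Z.:- k Z.:+ i)) Z.:+ d Z.:* ((a Z.:+ b) Z.:* (i Z.:+ n Z.:- k)))
         refl (+ A) (+ B) (+ n) k ⟩
  + A ℤ.* (k ℤ.* (k ℤ.+ + 1)) ℤ.+ + B ℤ.* (ℤ.- k ℤ.* (ℤ.- k ℤ.+ + 1)) ℤ.+ + 2 ℤ.* ((+ A ℤ.+ + B) ℤ.* (+ suc n ℤ.- k))
    ≡⟨ cong₂ (λ x y → x ℤ.+ + 2 ℤ.* ((+ A ℤ.+ + B) ℤ.* y)) (2*exponent A B k) hU ⟨
  + 2 ℤ.* + exponent A B k ℤ.+ + 2 ℤ.* ((+ A ℤ.+ + B) ℤ.* + U)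
    ≡⟨ ℤ.*-distribˡ-+ (+ 2) (+ exponent A B k) _ ⟨
  + 2 ℤ.* (+ exponent A B k ℤ.+ (+ A ℤ.+ + B) ℤ.* + U)
    ≡⟨ cong (λ x → + 2 ℤ.* (+ exponent A B k ℤ.+ x)) (ℤ.pos-* (A + B) U) ⟨
  + 2 ℤ.* + (exponent A B k + (A + B) * U) ∎)
  where open ≡-Reasoning

exponent-neg : ∀ A B k → exponent A B k ≡ exponent B A (ℤ.- k)
exponent-neg A B k = trans (ℕ.+-comm (A * triangle k) _)
  (cong (λ x → B * triangle (ℤ.- k) + A * triangle x) (sym (ℤ.neg-involutive k)))

-- The reflection of k to -k exchanges A and B and reduces this to `exponent-pred`.
exponent-suc : ∀ A B {n V k} → + V ≡ + suc n ℤ.+ k → (A + B) * n + B + exponent A B (ℤ.suc k) ≡ exponent A B k + (A + B) * V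
exponent-suc A B {n} {V} {k} hV = begin
  (A + B) * n + B + exponent A B (ℤ.suc k)
    ≡⟨ cong₂ (λ C x → C * n + B + x) (ℕ.+-comm A B)
         (trans (exponent-neg A B (ℤ.suc k)) (cong (exponent B A) (ℤ.neg-distrib-+ (+ 1) k))) ⟩
  (B + A) * n + B + exponent B A (ℤ.pred (ℤ.- k))
    ≡⟨ exponent-pred B A {k = ℤ.- k} (trans hV (cong (λ x → + suc n ℤ.+ x) (sym (ℤ.neg-involutive k)))) ⟩
  exponent B A (ℤ.- k) + (B + A) * V
    ≡⟨ cong₂ (λ x C → x + C * V) (sym (exponent-neg A B k)) (ℕ.+-comm B A) ⟩
  exponent A B k + (A + B) * V ∎
  where open ≡-Reasoning

-- One of k and -k equals ∣k∣, and its triangular number is at least ∣k∣. This is why `interval n`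
-- catches every term of degree at most n.
exponent-≥ : ∀ A B k → 1 ≤ A → 1 ≤ B → ∣ k ∣ ≤ exponent A B k
exponent-≥ A@(suc _) B@(suc _) k _ _ = ℕ.≤-trans (go k)
  (ℕ.+-mono-≤ (ℕ.m≤n*m (triangle k) A) (ℕ.m≤n*m (triangle (ℤ.- k)) B))
  where
  go : ∀ k → ∣ k ∣ ≤ triangle k + triangle (ℤ.- k)
  go (+ zero)  = z≤n
  go (+ suc n) = ℕ.≤-trans (ℕ.m≤m+n (suc n) _) (ℕ.m≤m+n (suc n + triangle (+ n)) _)
  go -[1+ n ]  = ℕ.≤-trans (ℕ.m≤m+n (suc n) _) (ℕ.m≤n+m (suc n + triangle (+ n)) (triangle -[1+ n ]))

-- The finite triple product and its limit

module Jacobi (A B : ℕ) (1≤A : 1 ≤ A) (1≤B : 1 ≤ B) where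

  C : ℕ
  C = A + B

  1≤C : 1 ≤ C
  1≤C = ℕ.≤-trans 1≤A (ℕ.m≤m+n A B)

  ex : ℤ → ℕ
  ex = exponent A B

  pochhammer : ℕ → Series₂
  pochhammer = prod (λ i → binomial (C * suc i))

  -- c (+ m) is the inverse of pochhammer m; the value 0 at negative arguments makes
  -- term n k below vanish for ∣ k ∣ > n.
  c : ℤ → Series₂
  c (+ m)    = prod (λ i → geometric (C * suc i)) m
  c -[1+ _ ] = 𝟘

  c-≡ : ∀ {i j} → i ≡ j → c i ≈ c j
  c-≡ refl = ≈-refl

  c-negative : ∀ {i} → i ℤ.< + 0 → c i ≈ 𝟘
  c-negative {+ _} (ℤ.+<+ ())
  c-negative { -[1+ _ ] } _ = ≈-refl

  pochhammer-inverse : ∀ m → pochhammer m ⊗ c (+ m) ≈ 𝟙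
  pochhammer-inverse m = ≈-trans (≈-sym (prod-⊗ _ _ m))
    (≈-trans (prod-cong (λ i → binomial-geometric (C * suc i) (1≤d*[1+n] C i 1≤C)) m) (prod-𝟙 m))

  -- At U = 0 both sides vanish, the right one because 1 - q⁰ = 0, so the boundary obeys the same
  -- rule as the interior.
  c-pred : ∀ U → c (ℤ.pred (+ U)) ≈ binomial (C * U) ⊗ c (+ U)
  c-pred zero = ≈-sym (begin
    binomial (C * 0) ⊗ 𝟙  ≈⟨ ⊗-cong (≈-trans (binomial-≡ (ℕ.*-zeroʳ C)) (⊕-cong {𝟙} ≈-refl mono-zero)) ≈-refl ⟩
    (𝟙 ⊕ 𝟙) ⊗ 𝟙           ≈⟨ ⊗-identityʳ _ ⟩
    𝟙 ⊕ 𝟙                 ≈⟨ mk (λ k → Bool.xor-same (𝟙 k)) ⟩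
    𝟘                     ∎)
    where open SetoidReasoning ≈-setoid
  c-pred (suc u) = ≈-sym (begin
    binomial (C * suc u) ⊗ (c (+ u) ⊗ geometric (C * suc u))
      ≈⟨ solve₂ 3 (λ x y z → x :* (y :* z) := y :* (x :* z)) ≈-refl (binomial (C * suc u)) (c (+ u)) (geometric (C * suc u)) ⟩
    c (+ u) ⊗ (binomial (C * suc u) ⊗ geometric (C * suc u))
      ≈⟨ ⊗-cong ≈-refl (binomial-geometric (C * suc u) (1≤d*[1+n] C u 1≤C)) ⟩
    c (+ u) ⊗ 𝟙
      ≈⟨ ⊗-identityʳ _ ⟩
    c (+ u) ∎)
    where open SetoidReasoning ≈-setoid

  -- Two steps down from V bring in 1 - q^{C(V-1)}, whose exponent is negative at V = 0. The factor
  -- q^{CU} repairs this, since q^{CU} q^{C(V-1)} = q^{Cm}.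
  c-pred² : ∀ {U V m} → U + V ≡ suc m →
            mono (C * U) ⊗ c (ℤ.pred (ℤ.pred (+ V))) ≈ (mono (C * U) ⊕ mono (C * m)) ⊗ c (ℤ.pred (+ V))
  c-pred² {U} {zero}  {m} _ = ≈-trans (mk λ k → trans (⊗-comm (mono (C * U)) 𝟘 k) (⊗-zeroˡ _ k))
    (mk λ k → sym (trans (⊗-comm (mono (C * U) ⊕ mono (C * m)) 𝟘 k) (⊗-zeroˡ _ k)))
  c-pred² {U} {suc v} {m} eq = begin
    mono (C * U) ⊗ c (ℤ.pred (+ v))
      ≈⟨ ⊗-cong ≈-refl (c-pred v) ⟩
    mono (C * U) ⊗ ((𝟙 ⊕ mono (C * v)) ⊗ c (+ v))
      ≈⟨ solve₂ 3 (λ x y z → x :* ((con true :+ y) :* z) := (x :+ x :* y) :* z) ≈-refl (mono (C * U)) (mono (C * v)) (c (+ v)) ⟩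
    (mono (C * U) ⊕ mono (C * U) ⊗ mono (C * v)) ⊗ c (+ v)
      ≈⟨ ⊗-cong (⊕-cong {mono (C * U)} ≈-refl (≈-trans (≈-sym (mono-+ (C * U) (C * v))) (mono-≡ exponents))) ≈-refl ⟩
    (mono (C * U) ⊕ mono (C * m)) ⊗ c (+ v) ∎
    where
    open SetoidReasoning ≈-setoid
    exponents : C * U + C * v ≡ C * m
    exponents = trans (sym (ℕ.*-distribˡ-+ C U v)) (cong (C *_) (ℕ.suc-injective (trans (sym (ℕ.+-suc U v)) eq)))

  -- Times `pochhammer (n + n)` this is q^{`ex k`} times the Gaussian binomial of 2n over n + k in
  -- base q^C. The common numerator is kept outside the sum over k.
  term : ℕ → ℤ → Series₂
  term n k = mono (exponent A B k) ⊗ (c (+ n ℤ.- k) ⊗ c (+ n ℤ.+ k))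

  term-vanish : ∀ n k → n < ∣ k ∣ → term n k ≈ 𝟘
  term-vanish n (+ k) n<k = ≈-trans (⊗-cong ≈-refl (⊗-cong (c-negative neg) ≈-refl))
    (mk λ i → trans (⊗-comm (mono (exponent A B (+ k))) (𝟘 ⊗ c (+ n ℤ.+ + k)) i)
                    (trans (⊗-assoc 𝟘 (c (+ n ℤ.+ + k)) _ i) (⊗-zeroˡ _ i)))
    where
    neg : + n ℤ.- + k ℤ.< + 0
    neg = ℤ.<-≤-trans (ℤ.+-monoˡ-< (ℤ.- + k) (ℤ.+<+ n<k)) (ℤ.≤-reflexive (ℤ.+-inverseʳ (+ k)))
  term-vanish n -[1+ k ] n<k = ≈-trans (⊗-cong ≈-refl (⊗-cong ≈-refl (c-negative neg)))
    (mk λ i → trans (sym (⊗-assoc (mono (exponent A B -[1+ k ])) (c (+ n ℤ.+ + suc k)) 𝟘 i))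
                    (trans (⊗-comm _ 𝟘 i) (⊗-zeroˡ _ i)))
    where
    neg : + n ℤ.- + suc k ℤ.< + 0
    neg = ℤ.<-≤-trans (ℤ.+-monoˡ-< (ℤ.- + suc k) (ℤ.+<+ n<k)) (ℤ.≤-reflexive (ℤ.+-inverseʳ (+ suc k)))

  nonneg-complements : ∀ {n k} → ∣ k ∣ ≤ n →
    ∃₂ λ U V → + U ≡ + n ℤ.- k × + V ≡ + n ℤ.+ k × U + V ≡ n + n
  nonneg-complements {n} {+ k}     k≤n = n ∸ k , n + k
    , trans (sym (ℤ.⊖-≥ k≤n)) (sym (ℤ.m-n≡m⊖n n k)) , refl
    , trans (cong (λ x → n ∸ k + x) (ℕ.+-comm n k)) (trans (sym (ℕ.+-assoc (n ∸ k) k n)) (cong (_+ n) (ℕ.m∸n+n≡m k≤n)))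
  nonneg-complements {n} { -[1+ k ] } k≤n = n + suc k , n ∸ suc k
    , refl , trans (sym (ℤ.⊖-≥ k≤n)) (sym (ℤ.m-n≡m⊖n n (suc k)))
    , trans (ℕ.+-assoc n (suc k) _) (cong (λ x → n + x) (ℕ.m+[n∸m]≡n k≤n))

  -- Multiplying by the next two factors relates the coefficients at k - 1, k and k + 1; with x = q^{CU},
  -- y = q^{CV} and s = q^{C(2n+1)}, where U + V = 2n + 2, it is an identity of polynomials in x, y, s.
  term-suc : ∀ n k → ∣ k ∣ ≤ suc n →
    binomial (C * suc (n + n)) ⊗ binomial (C * suc (suc (n + n))) ⊗ term (suc n) k ≈
    (𝟙 ⊕ mono (C * suc (n + n))) ⊗ term n k
      ⊕ mono (C * n + A) ⊗ term n (ℤ.pred k)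
      ⊕ mono (C * n + B) ⊗ term n (ℤ.suc k)
  term-suc n k ∣k∣≤1+n with nonneg-complements {suc n} {k} ∣k∣≤1+n
  ... | U , V , hU , hV , U+V = ≈-sym (begin
    (𝟙 ⊕ s) ⊗ term n k
      ⊕ mono (C * n + A) ⊗ term n (ℤ.pred k)
      ⊕ mono (C * n + B) ⊗ term n (ℤ.suc k)
      ≈⟨ ⊕-cong {(𝟙 ⊕ s) ⊗ term n k ⊕ mono (C * n + A) ⊗ term n (ℤ.pred k)}
           (⊕-cong {(𝟙 ⊕ s) ⊗ term n k} (⊗-cong ≈-refl middle) left) right ⟩
    (𝟙 ⊕ s) ⊗ (e ⊗ (((𝟙 ⊕ x) ⊗ cU) ⊗ ((𝟙 ⊕ y) ⊗ cV)))
      ⊕ e ⊗ (cU ⊗ ((x ⊕ s) ⊗ ((𝟙 ⊕ y) ⊗ cV)))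
      ⊕ e ⊗ (cV ⊗ ((y ⊕ s) ⊗ ((𝟙 ⊕ x) ⊗ cU)))
      ≈⟨ solve₂ 6 (λ s e x y u v → let i = con true in
           (i :+ s) :* (e :* (((i :+ x) :* u) :* ((i :+ y) :* v)))
             :+ e :* (u :* ((x :+ s) :* ((i :+ y) :* v)))
             :+ e :* (v :* ((y :+ s) :* ((i :+ x) :* u)))
           := (i :+ s) :* (i :+ x :* y) :* (e :* (u :* v))) ≈-refl s e x y cU cV ⟩
    (𝟙 ⊕ s) ⊗ (𝟙 ⊕ x ⊗ y) ⊗ (e ⊗ (cU ⊗ cV))
      ≈⟨ ⊗-cong (⊗-cong ≈-refl (⊕-cong {𝟙} ≈-refl x⊗y))
                (⊗-cong ≈-refl (⊗-cong (c-≡ hU) (c-≡ hV))) ⟩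
    binomial (C * suc (n + n)) ⊗ binomial (C * suc (suc (n + n))) ⊗ term (suc n) k ∎)
    where
    open SetoidReasoning ≈-setoid
    s e x y cU cV : Series₂
    s  = mono (C * suc (n + n))
    e  = mono (exponent A B k)
    x  = mono (C * U)
    y  = mono (C * V)
    cU = c (+ U)
    cV = c (+ V)
    U+V′ : U + V ≡ suc (suc (n + n))
    U+V′ = trans U+V (cong suc (ℕ.+-suc n n))
    x⊗y : x ⊗ y ≈ mono (C * suc (suc (n + n)))
    x⊗y = ≈-trans (≈-sym (mono-+ (C * U) (C * V)))
      (mono-≡ (trans (sym (ℕ.*-distribˡ-+ C U V)) (cong (C *_) U+V′)))
    n-k : + n ℤ.- k ≡ ℤ.pred (+ U)
    n-k = trans (solveℤ 2 (λ n k → n Z.:- k Z.:= Z.con (ℤ.- + 1) Z.:+ (Z.con (+ 1) Z.:+ n Z.:- k)) refl (+ n) k)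
                (cong ℤ.pred (sym hU))
    n+k : + n ℤ.+ k ≡ ℤ.pred (+ V)
    n+k = trans (solveℤ 2 (λ n k → n Z.:+ k Z.:= Z.con (ℤ.- + 1) Z.:+ (Z.con (+ 1) Z.:+ n Z.:+ k)) refl (+ n) k)
                (cong ℤ.pred (sym hV))
    middle : term n k ≈ e ⊗ (((𝟙 ⊕ x) ⊗ cU) ⊗ ((𝟙 ⊕ y) ⊗ cV))
    middle = ⊗-cong ≈-refl (⊗-cong (≈-trans (c-≡ n-k) (c-pred U)) (≈-trans (c-≡ n+k) (c-pred V)))
    left : mono (C * n + A) ⊗ term n (ℤ.pred k) ≈ e ⊗ (cU ⊗ ((x ⊕ s) ⊗ ((𝟙 ⊕ y) ⊗ cV)))
    left = begin
      mono (C * n + A) ⊗ (mono (exponent A B (ℤ.pred k)) ⊗ (c (+ n ℤ.- ℤ.pred k) ⊗ c (+ n ℤ.+ ℤ.pred k)))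
        ≈⟨ mk (⊗-assoc (mono (C * n + A)) _ _) ⟨
      (mono (C * n + A) ⊗ mono (exponent A B (ℤ.pred k))) ⊗ (c (+ n ℤ.- ℤ.pred k) ⊗ c (+ n ℤ.+ ℤ.pred k))
        ≈⟨ ⊗-cong (≈-trans (≈-sym (mono-+ (C * n + A) _)) (≈-trans (mono-≡ (exponent-pred A B {k = k} hU)) (mono-+ (exponent A B k) (C * U))))
             (⊗-cong (c-≡ (trans (solveℤ 2 (λ n k → n Z.:- (Z.con (ℤ.- + 1) Z.:+ k) Z.:= Z.con (+ 1) Z.:+ n Z.:- k) refl (+ n) k) (sym hU)))
                     (c-≡ (trans (solveℤ 2 (λ n k → n Z.:+ (Z.con (ℤ.- + 1) Z.:+ k) Z.:= Z.con (ℤ.- + 1) Z.:+ (n Z.:+ k)) refl (+ n) k) (cong ℤ.pred n+k)))) ⟩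
      (e ⊗ x) ⊗ (cU ⊗ c (ℤ.pred (ℤ.pred (+ V))))
        ≈⟨ solve₂ 4 (λ e x u v → (e :* x) :* (u :* v) := e :* (u :* (x :* v))) ≈-refl e x cU (c (ℤ.pred (ℤ.pred (+ V)))) ⟩
      e ⊗ (cU ⊗ (x ⊗ c (ℤ.pred (ℤ.pred (+ V)))))
        ≈⟨ ⊗-cong ≈-refl (⊗-cong ≈-refl (≈-trans (c-pred² {U} {V} U+V′) (⊗-cong ≈-refl (c-pred V)))) ⟩
      e ⊗ (cU ⊗ ((x ⊕ s) ⊗ ((𝟙 ⊕ y) ⊗ cV))) ∎
    right : mono (C * n + B) ⊗ term n (ℤ.suc k) ≈ e ⊗ (cV ⊗ ((y ⊕ s) ⊗ ((𝟙 ⊕ x) ⊗ cU)))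
    right = begin
      mono (C * n + B) ⊗ (mono (exponent A B (ℤ.suc k)) ⊗ (c (+ n ℤ.- ℤ.suc k) ⊗ c (+ n ℤ.+ ℤ.suc k)))
        ≈⟨ mk (⊗-assoc (mono (C * n + B)) _ _) ⟨
      (mono (C * n + B) ⊗ mono (exponent A B (ℤ.suc k))) ⊗ (c (+ n ℤ.- ℤ.suc k) ⊗ c (+ n ℤ.+ ℤ.suc k))
        ≈⟨ ⊗-cong (≈-trans (≈-sym (mono-+ (C * n + B) _)) (≈-trans (mono-≡ (exponent-suc A B {k = k} hV)) (mono-+ (exponent A B k) (C * V))))
             (⊗-cong (c-≡ (trans (solveℤ 2 (λ n k → n Z.:- (Z.con (+ 1) Z.:+ k) Z.:= Z.con (ℤ.- + 1) Z.:+ (n Z.:- k)) refl (+ n) k) (cong ℤ.pred n-k)))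
                     (c-≡ (trans (solveℤ 2 (λ n k → n Z.:+ (Z.con (+ 1) Z.:+ k) Z.:= Z.con (+ 1) Z.:+ n Z.:+ k) refl (+ n) k) (sym hV)))) ⟩
      (e ⊗ y) ⊗ (c (ℤ.pred (ℤ.pred (+ U))) ⊗ cV)
        ≈⟨ solve₂ 4 (λ e y u v → (e :* y) :* (u :* v) := e :* (v :* (y :* u))) ≈-refl e y (c (ℤ.pred (ℤ.pred (+ U)))) cV ⟩
      e ⊗ (cV ⊗ (y ⊗ c (ℤ.pred (ℤ.pred (+ U)))))
        ≈⟨ ⊗-cong ≈-refl (⊗-cong ≈-refl (≈-trans (c-pred² {V} {U} (trans (ℕ.+-comm V U) U+V′)) (⊗-cong ≈-refl (c-pred U)))) ⟩
      e ⊗ (cV ⊗ ((y ⊕ s) ⊗ ((𝟙 ⊕ x) ⊗ cU))) ∎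

  thetaFactor : ℕ → Series₂
  thetaFactor n = binomial (C * n + A) ⊗ binomial (C * n + B)

  -- The next factor is (1 + α)(1 + β) = (1 + αβ) + α + β with αβ = q^{C(2n+1)}. Summing `term-suc`
  -- over k gives just these three multiples of the old sum, since those with α and β only translate
  -- k.
  finite-triple-product : ∀ n → prod thetaFactor n ≈ pochhammer (n + n) ⊗ ∑ˢ (interval n) (term n)
  finite-triple-product zero = ≈-sym (≈-trans (⊗-identityˡ _) (begin
    mono (A * 0 + B * 0) ⊗ (𝟙 ⊗ 𝟙) ⊕ 𝟘  ≈⟨ mk (λ k → Bool.xor-identityʳ _) ⟩
    mono (A * 0 + B * 0) ⊗ (𝟙 ⊗ 𝟙)
      ≈⟨ ⊗-cong (≈-trans (mono-≡ (cong₂ _+_ (ℕ.*-zeroʳ A) (ℕ.*-zeroʳ B))) mono-zero) (⊗-identityˡ 𝟙) ⟩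
    𝟙 ⊗ 𝟙                                ≈⟨ ⊗-identityˡ 𝟙 ⟩
    𝟙                                    ∎))
    where open SetoidReasoning ≈-setoid
  finite-triple-product (suc n) = ≈-sym (begin
    pochhammer (suc n + suc n) ⊗ ∑ˢ I′ (term (suc n))
      ≈⟨ ⊗-cong (mk λ i → cong (λ m → pochhammer m i) (cong suc (ℕ.+-suc n n))) ≈-refl ⟩
    (p ⊗ b₁ ⊗ b₂) ⊗ ∑ˢ I′ (term (suc n))
      ≈⟨ solve₂ 4 (λ p b₁ b₂ t → p :* b₁ :* b₂ :* t := p :* (b₁ :* b₂ :* t)) ≈-refl p b₁ b₂ (∑ˢ I′ (term (suc n))) ⟩
    p ⊗ (b₁ ⊗ b₂ ⊗ ∑ˢ I′ (term (suc n)))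
      ≈⟨ ⊗-cong ≈-refl (⊗-∑ˢ (b₁ ⊗ b₂) I′ (term (suc n))) ⟩
    p ⊗ ∑ˢ I′ (λ k → b₁ ⊗ b₂ ⊗ term (suc n) k)
      ≈⟨ ⊗-cong ≈-refl (∑ˢ-cong I′ (λ k k∈ → term-suc n k (∈-interval⁻ k∈))) ⟩
    p ⊗ ∑ˢ I′ (λ k → (𝟙 ⊕ s) ⊗ term n k ⊕ α ⊗ term n (ℤ.pred k) ⊕ β ⊗ term n (ℤ.suc k))
      ≈⟨ ⊗-cong ≈-refl (≈-trans
             (∑ˢ-⊕ I′ (λ k → (𝟙 ⊕ s) ⊗ term n k ⊕ α ⊗ term n (ℤ.pred k)) (λ k → β ⊗ term n (ℤ.suc k)))
             (⊕-cong (∑ˢ-⊕ I′ (λ k → (𝟙 ⊕ s) ⊗ term n k) (λ k → α ⊗ term n (ℤ.pred k)))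
                     (≈-refl {∑ˢ I′ (λ k → β ⊗ term n (ℤ.suc k))}))) ⟩
    p ⊗ (∑ˢ I′ (λ k → (𝟙 ⊕ s) ⊗ term n k) ⊕ ∑ˢ I′ (λ k → α ⊗ term n (ℤ.pred k)) ⊕ ∑ˢ I′ (λ k → β ⊗ term n (ℤ.suc k)))
      ≈⟨ ⊗-cong ≈-refl (⊕-cong (⊕-cong (⊗-∑ˢ (𝟙 ⊕ s) I′ _) (⊗-∑ˢ α I′ _)) (⊗-∑ˢ β I′ _)) ⟨
    p ⊗ ((𝟙 ⊕ s) ⊗ ∑ˢ I′ (term n) ⊕ α ⊗ ∑ˢ I′ (λ k → term n (ℤ.pred k)) ⊕ β ⊗ ∑ˢ I′ (λ k → term n (ℤ.suc k)))
      ≈⟨ ⊗-cong ≈-refl (⊕-cong (⊕-cong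
           (⊗-cong ≈-refl (mk λ i → ∑-interval-suc {n = n} (vanish i)))
           (⊗-cong ≈-refl (mk λ i → ∑-interval-shiftʳ {n = n} (vanish i))))
           (⊗-cong ≈-refl (mk λ i → ∑-interval-shiftˡ {n = n} (vanish i)))) ⟩
    p ⊗ ((𝟙 ⊕ s) ⊗ S₀ ⊕ α ⊗ S₀ ⊕ β ⊗ S₀)
      ≈⟨ ⊗-cong ≈-refl (⊕-cong (⊕-cong (⊗-cong (⊕-cong {𝟙} ≈-refl s≈) ≈-refl) ≈-refl) ≈-refl) ⟩
    p ⊗ ((𝟙 ⊕ α ⊗ β) ⊗ S₀ ⊕ α ⊗ S₀ ⊕ β ⊗ S₀)
      ≈⟨ solve₂ 4 (λ p a b S₀ → let i = con true in
           p :* ((i :+ a :* b) :* S₀ :+ a :* S₀ :+ b :* S₀) := p :* S₀ :* ((i :+ a) :* (i :+ b))) ≈-refl p α β S₀ ⟩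
    p ⊗ S₀ ⊗ ((𝟙 ⊕ α) ⊗ (𝟙 ⊕ β))
      ≈⟨ ⊗-cong (finite-triple-product n) ≈-refl ⟨
    prod thetaFactor n ⊗ thetaFactor n ∎)
    where
    open SetoidReasoning ≈-setoid
    I′ : List ℤ
    I′ = interval (suc n)
    p b₁ b₂ s α β S₀ : Series₂
    p  = pochhammer (n + n)
    b₁ = binomial (C * suc (n + n))
    b₂ = binomial (C * suc (suc (n + n)))
    s  = mono (C * suc (n + n))
    α  = mono (C * n + A)
    β  = mono (C * n + B)
    S₀ = ∑ˢ (interval n) (term n)
    vanish : ∀ i k → n < ∣ k ∣ → term n k i ≡ false
    vanish i k n<∣k∣ = coeff (term-vanish n k n<∣k∣) i
    s≈ : s ≈ α ⊗ β
    s≈ = ≈-trans (mono-≡ (solveℕ 3 (λ a b n → (a N.:+ b) N.:* (N.con 1 N.:+ (n N.:+ n))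
           N.:= (a N.:+ b) N.:* n N.:+ a N.:+ ((a N.:+ b) N.:* n N.:+ b)) refl A B n)) (mono-+ (C * n + A) (C * n + B))

  thetaFactor-admissible : Admissible thetaFactor
  thetaFactor-admissible n = ⊗-≈[]𝟙 (binomial-≈[]𝟙 (bound A 1≤A)) (binomial-≈[]𝟙 (bound B 1≤B))
    where
    n≤C*n : n ≤ C * n
    n≤C*n = ℕ.≤-trans (ℕ.≤-reflexive (sym (ℕ.*-identityˡ n))) (ℕ.*-monoˡ-≤ n 1≤C)
    bound : ∀ D → 1 ≤ D → n < C * n + D
    bound D 1≤D = ℕ.≤-trans (ℕ.≤-reflexive (ℕ.+-comm 1 n)) (ℕ.+-mono-≤ n≤C*n 1≤D)

  pochhammer-limit : ∀ {m n} → m ≤ n → pochhammer n ≈[ m ] euler C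
  pochhammer-limit = prod-≈[]-∏∞ (binomial-admissible C 1≤C)

  -- With U = n - k and V = n + k, the cofactor of the monomial is 1 only up to degree min(U, V) = n
  -- - ∣k∣. The monomial itself contributes at least ∣k∣ further degrees.
  term-limit : ∀ n k → ∣ k ∣ ≤ n → euler C ⊗ (pochhammer (n + n) ⊗ term n k) ≈[ n ] mono (exponent A B k)
  term-limit n k ∣k∣≤n with nonneg-complements {n} {k} ∣k∣≤n
  ... | U , V , hU , hV , U+V = ≈[]-weaken n≤e+w (≈[]-trans (≈⇒≈[] rearrange)
      (≈[]-trans (mono-⊗-cong[] (exponent A B k) near-one) (≈⇒≈[] (⊗-identityʳ _))))
    where
    w : ℕ
    w = U ⊓ V
    rearrange : euler C ⊗ (pochhammer (n + n) ⊗ term n k)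
                ≈ mono (exponent A B k) ⊗ ((euler C ⊗ c (+ U)) ⊗ (pochhammer (n + n) ⊗ c (+ V)))
    rearrange = ≈-trans
      (⊗-cong (≈-refl {euler C}) (⊗-cong (≈-refl {pochhammer (n + n)}) (⊗-cong (≈-refl {mono (exponent A B k)})
        (⊗-cong (c-≡ (sym hU)) (c-≡ (sym hV))))))
      (solve₂ 5 (λ E p m x y → E :* (p :* (m :* (x :* y))) := m :* ((E :* x) :* (p :* y)))
        ≈-refl (euler C) (pochhammer (n + n)) (mono (exponent A B k)) (c (+ U)) (c (+ V)))
    w≤2n : w ≤ n + n
    w≤2n = ℕ.≤-trans (ℕ.m⊓n≤m U V) (ℕ.≤-trans (ℕ.m≤m+n U V) (ℕ.≤-reflexive U+V))
    near-one : (euler C ⊗ c (+ U)) ⊗ (pochhammer (n + n) ⊗ c (+ V)) ≈[ w ] 𝟙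
    near-one = ⊗-≈[]𝟙
      (≈[]-trans (⊗-cong[] (≈[]-sym (pochhammer-limit (ℕ.m⊓n≤m U V))) (≈⇒≈[] ≈-refl)) (≈⇒≈[] (pochhammer-inverse U)))
      (≈[]-trans (⊗-cong[] (≈[]-trans (pochhammer-limit w≤2n) (≈[]-sym (pochhammer-limit (ℕ.m⊓n≤n U V)))) (≈⇒≈[] ≈-refl))
        (≈⇒≈[] (pochhammer-inverse V)))
    n≤∣k∣+ : ∀ u {j} → + u ≡ + n ℤ.+ j → n ≤ ∣ j ∣ + u
    n≤∣k∣+ u {j} eq = ℕ.≤-trans (ℕ.≤-reflexive (cong ∣_∣ n≡))
      (ℕ.≤-trans (ℤ.∣i+j∣≤∣i∣+∣j∣ (ℤ.- j) (+ u)) (ℕ.≤-reflexive (cong (_+ u) (ℤ.∣-i∣≡∣i∣ j))))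
      where
      n≡ : + n ≡ ℤ.- j ℤ.+ + u
      n≡ = trans (solveℤ 2 (λ n j → n Z.:= Z.:- j Z.:+ (n Z.:+ j)) refl (+ n) j) (cong (λ x → ℤ.- j ℤ.+ x) (sym eq))
    n≤e+w : n ≤ exponent A B k + w
    n≤e+w = ℕ.≤-trans
      (ℕ.≤-trans (ℕ.⊓-glb (subst (λ x → n ≤ x + U) (ℤ.∣-i∣≡∣i∣ k) (n≤∣k∣+ U {ℤ.- k} hU)) (n≤∣k∣+ V {k} hV))
                 (ℕ.≤-reflexive (sym (ℕ.+-distribˡ-⊓ ∣ k ∣ U V))))
      (ℕ.+-monoˡ-≤ w (exponent-≥ A B k 1≤A 1≤B))

  triple-product : ∀ n → ∑ˢ (interval n) (λ k → mono (exponent A B k)) ≈[ n ] ∏∞ (λ n → thetaFactor n ⊗ binomial (C * suc n))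
  triple-product n = ≈[]-sym (begin
    ∏∞ (λ n → thetaFactor n ⊗ binomial (C * suc n))
      ≈⟨ ≈⇒≈[] (∏∞-⊗ thetaFactor-admissible (binomial-admissible C 1≤C)) ⟩
    ∏∞ thetaFactor ⊗ euler C
      ≈⟨ ≈⇒≈[] (mk (⊗-comm (∏∞ thetaFactor) (euler C))) ⟩
    euler C ⊗ ∏∞ thetaFactor
      ≈⟨ ⊗-cong[] (≈⇒≈[] ≈-refl) (prod-≈[]-∏∞ thetaFactor-admissible (ℕ.≤-refl {n})) ⟨
    euler C ⊗ prod thetaFactor n
      ≈⟨ ≈⇒≈[] (⊗-cong (≈-refl {euler C}) (finite-triple-product n)) ⟩
    euler C ⊗ (pochhammer (n + n) ⊗ ∑ˢ (interval n) (term n))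
      ≈⟨ ≈⇒≈[] (≈-trans (⊗-cong (≈-refl {euler C}) (⊗-∑ˢ (pochhammer (n + n)) (interval n) (term n))) (⊗-∑ˢ (euler C) (interval n) _)) ⟩
    ∑ˢ (interval n) (λ k → euler C ⊗ (pochhammer (n + n) ⊗ term n k))
      ≈⟨ ∑ˢ-cong[] (interval n) (λ k k∈ → term-limit n k (∈-interval⁻ k∈)) ⟩
    ∑ˢ (interval n) (λ k → mono (exponent A B k)) ∎)
    where open SetoidReasoning (≈[]-setoid n)

-- Theta series as eta products

prod-block : ∀ F d m → prod F (d + m) ≈ prod F m ⊗ prod (λ i → F (i + m)) d
prod-block F zero    m = ≈-sym (⊗-identityʳ _)
prod-block F (suc d) m = ≈-trans (⊗-cong (prod-block F d m) ≈-refl)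
  (mk (⊗-assoc (prod F m) (prod (λ i → F (i + m)) d) (F (d + m))))

-- Degree k is settled by the first k factors, hence also by the first k(d + 1), which form k whole
-- blocks.
∏∞-blocks : ∀ {F} d → Admissible F → ∏∞ F ≈ ∏∞ (λ n → prod (λ i → F (i + n * suc d)) (suc d))
∏∞-blocks {F} d adm = mk λ k → trans
  (sym (coeff≤ (prod-stable adm (ℕ.m≤m*n k (suc d))) k ℕ.≤-refl)) (coeff (go k) k)
  where
  go : ∀ n → prod F (n * suc d) ≈ prod (λ n → prod (λ i → F (i + n * suc d)) (suc d)) n
  go zero    = ≈-refl
  go (suc n) = ≈-trans (prod-block F (suc d) (n * suc d)) (⊗-cong (go n) ≈-refl)

block-admissible : ∀ {F} d → Admissible F → Admissible (λ n → prod (λ i → F (i + n * suc d)) (suc d))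
block-admissible {F} d adm n = go (suc d)
  where
  go : ∀ j → prod (λ i → F (i + n * suc d)) j ≈[ n ] 𝟙
  go zero    = ≈⇒≈[] ≈-refl
  go (suc j) = ⊗-≈[]𝟙 (go j) (≈[]-weaken (ℕ.≤-trans (ℕ.m≤m*n n (suc d)) (ℕ.m≤n+m _ j)) (adm (j + n * suc d)))

module J₄₁ = Jacobi 4 1 (s≤s z≤n) (s≤s z≤n)
module J₃₂ = Jacobi 3 2 (s≤s z≤n) (s≤s z≤n)

tripleProduct : ℕ → ℕ → Series₂
tripleProduct A B = ∏∞ (λ n → binomial ((A + B) * n + A) ⊗ binomial ((A + B) * n + B) ⊗ binomial ((A + B) * suc n))

-- The residues 4, 1, 3, 2 modulo 5 and one of the two copies of the multiples of 5 make up E 1; the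
-- other copy is E 5.
tripleProduct-41-32 : tripleProduct 4 1 ⊗ tripleProduct 3 2 ≈ euler 1 ⊗ euler 5
tripleProduct-41-32 = ≈-trans
  (≈-sym (∏∞-⊗ (λ n → ⊗-≈[]𝟙 (J₄₁.thetaFactor-admissible n) (binomial-admissible 5 (s≤s z≤n) n))
               (λ n → ⊗-≈[]𝟙 (J₃₂.thetaFactor-admissible n) (binomial-admissible 5 (s≤s z≤n) n))))
  (≈-trans (∏∞-cong regroup)
  (≈-trans (∏∞-⊗ (block-admissible 4 (binomial-admissible 1 (s≤s z≤n))) (binomial-admissible 5 (s≤s z≤n)))
           (⊗-cong (≈-sym (∏∞-blocks 4 (binomial-admissible 1 (s≤s z≤n)))) ≈-refl)))
  where
  module _ (n : ℕ) where
    b : ℕ → Series₂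
    b i = binomial (1 * suc (i + n * 5))
    b≈ : ∀ i r → 1 * suc (i + n * 5) ≡ 5 * n + r → binomial (5 * n + r) ≈ b i
    b≈ i r eq = binomial-≡ (sym eq)
    regroup : (binomial (5 * n + 4) ⊗ binomial (5 * n + 1) ⊗ binomial (5 * suc n))
              ⊗ (binomial (5 * n + 3) ⊗ binomial (5 * n + 2) ⊗ binomial (5 * suc n))
              ≈ prod b 5 ⊗ binomial (5 * suc n)
    regroup = ≈-trans
      (⊗-cong (⊗-cong (⊗-cong (b≈ 3 4 (index 3)) (b≈ 0 1 (index 0))) last)
              (⊗-cong (⊗-cong (b≈ 2 3 (index 2)) (b≈ 1 2 (index 1))) (≈-refl {binomial (5 * suc n)})))
      (solve₂ 6 (λ b₀ b₁ b₂ b₃ b₄ d → b₃ :* b₀ :* b₄ :* (b₂ :* b₁ :* d)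
                  := con true :* b₀ :* b₁ :* b₂ :* b₃ :* b₄ :* d)
        ≈-refl (b 0) (b 1) (b 2) (b 3) (b 4) (binomial (5 * suc n)))
      where
      index : ∀ i → 1 * suc (i + n * 5) ≡ 5 * n + suc i
      index i = solveℕ 2 (λ i n → N.con 1 N.:* (N.con 1 N.:+ (i N.:+ n N.:* N.con 5)) N.:= N.con 5 N.:* n N.:+ (N.con 1 N.:+ i)) refl i n
      last : binomial (5 * suc n) ≈ b 4
      last = binomial-≡ (solveℕ 1 (λ n → N.con 5 N.:* (N.con 1 N.:+ n) N.:= N.con 1 N.:* (N.con 1 N.:+ (N.con 4 N.:+ n N.:* N.con 5))) refl n)

-- In units of m the product covers the residues 3, 1, 0 modulo 4, so it is E(m) E(4m) / E(2m).
-- Modulo 2 this is E · E⁴ / E² = E³ with E = E(m).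
tripleProduct-3m-m : ∀ m → 1 ≤ m → tripleProduct (3 * m) m ≈ pow₂ (euler m) 3
tripleProduct-3m-m m 1≤m = begin
  θ                                 ≈⟨ ⊗-identityʳ θ ⟨
  θ ⊗ 𝟙                             ≈⟨ ⊗-cong (≈-refl {θ}) (pow₂-𝟙 (euler-inverse m 1≤m)) ⟨
  θ ⊗ pow₂ (E ⊗ I) 2                ≈⟨ solve₂ 3 (λ t e i → t :* (e :* i) :^ 2 := (t :* e :^ 2) :* i :^ 2) ≈-refl θ E I ⟩
  (θ ⊗ pow₂ E 2) ⊗ pow₂ I 2         ≈⟨ ⊗-cong (⊗-cong (≈-refl {θ}) (euler-double m 1≤m)) ≈-refl ⟨
  (θ ⊗ euler (2 * m)) ⊗ pow₂ I 2    ≈⟨ ⊗-cong complete ≈-refl ⟩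
  (E ⊗ euler (2 * (2 * m))) ⊗ pow₂ I 2
    ≈⟨ ⊗-cong (⊗-cong (≈-refl {E}) (≈-trans (euler-double (2 * m) 1≤2m) (pow₂-cong 2 (euler-double m 1≤m)))) ≈-refl ⟩
  (E ⊗ pow₂ (pow₂ E 2) 2) ⊗ pow₂ I 2
    ≈⟨ solve₂ 2 (λ e i → (e :* (e :^ 2) :^ 2) :* i :^ 2 := e :^ 3 :* (e :* i) :^ 2) ≈-refl E I ⟩
  pow₂ E 3 ⊗ pow₂ (E ⊗ I) 2         ≈⟨ ⊗-cong (≈-refl {pow₂ E 3}) (pow₂-𝟙 (euler-inverse m 1≤m)) ⟩
  pow₂ E 3 ⊗ 𝟙                      ≈⟨ ⊗-identityʳ _ ⟩
  pow₂ E 3                          ∎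
  where
  open SetoidReasoning ≈-setoid
  module J = Jacobi (3 * m) m (ℕ.≤-trans 1≤m (ℕ.m≤m+n m _)) 1≤m
  θ E I : Series₂
  θ = tripleProduct (3 * m) m
  E = euler m
  I = euler⁻¹ m
  pow₂-𝟙 : ∀ {f} → f ≈ 𝟙 → pow₂ f 2 ≈ 𝟙
  pow₂-𝟙 p = ≈-trans (pow₂-cong 2 p) (solve₂ 0 (con true :^ 2 := con true) ≈-refl)
  1≤2m : 1 ≤ 2 * m
  1≤2m = ℕ.≤-trans 1≤m (ℕ.m≤m+n m _)
  1≤4m : 1 ≤ 2 * (2 * m)
  1≤4m = ℕ.≤-trans 1≤2m (ℕ.m≤m+n (2 * m) _)
  b b′ : ℕ → Series₂
  b  i = binomial (m * suc i)
  b′ i = binomial (2 * m * suc i)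
  regroup : ∀ n → (binomial ((3 * m + m) * n + 3 * m) ⊗ binomial ((3 * m + m) * n + m) ⊗ binomial ((3 * m + m) * suc n))
                  ⊗ prod (λ i → b′ (i + n * 2)) 2
                  ≈ prod (λ i → b (i + n * 4)) 4 ⊗ binomial (2 * (2 * m) * suc n)
  regroup n = ≈-trans
    (⊗-cong (⊗-cong (⊗-cong
        (binomial-≡ {b = m * suc (2 + n * 4)} (solveℕ 2 (λ m n → (c 3 N.:* m N.:+ m) N.:* n N.:+ c 3 N.:* m N.:= m N.:* (c 1 N.:+ (c 2 N.:+ n N.:* c 4))) refl m n))
        (binomial-≡ {b = m * suc (n * 4)} (solveℕ 2 (λ m n → (c 3 N.:* m N.:+ m) N.:* n N.:+ m N.:= m N.:* (c 1 N.:+ n N.:* c 4)) refl m n)))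
        (binomial-≡ {b = m * suc (3 + n * 4)} (solveℕ 2 (λ m n → (c 3 N.:* m N.:+ m) N.:* (c 1 N.:+ n) N.:= m N.:* (c 1 N.:+ (c 3 N.:+ n N.:* c 4))) refl m n)))
      (⊗-cong (⊗-cong (≈-refl {𝟙})
        (binomial-≡ {b = m * suc (1 + n * 4)} (solveℕ 2 (λ m n → c 2 N.:* m N.:* (c 1 N.:+ n N.:* c 2) N.:= m N.:* (c 1 N.:+ (c 1 N.:+ n N.:* c 4))) refl m n)))
        (binomial-≡ {b = 2 * (2 * m) * suc n} (solveℕ 2 (λ m n → c 2 N.:* m N.:* (c 1 N.:+ (c 1 N.:+ n N.:* c 2)) N.:= c 2 N.:* (c 2 N.:* m) N.:* (c 1 N.:+ n)) refl m n))))
    (solve₂ 5 (λ b₀ b₁ b₂ b₃ d → b₂ :* b₀ :* b₃ :* (con true :* b₁ :* d) := con true :* b₀ :* b₁ :* b₂ :* b₃ :* d)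
      ≈-refl (b (n * 4)) (b (1 + n * 4)) (b (2 + n * 4)) (b (3 + n * 4)) (binomial (2 * (2 * m) * suc n)))
    where
    c : ∀ {n} → ℕ → N.Polynomial n
    c = N.con
  -- The factor 2m supplies the residue class modulo 4 that the triple product omits.
  complete : θ ⊗ euler (2 * m) ≈ E ⊗ euler (2 * (2 * m))
  complete = begin
    θ ⊗ euler (2 * m)
      ≈⟨ ⊗-cong (≈-refl {θ}) (∏∞-blocks 1 (binomial-admissible (2 * m) 1≤2m)) ⟩
    θ ⊗ ∏∞ (λ n → prod (λ i → b′ (i + n * 2)) 2)
      ≈⟨ ∏∞-⊗ (λ n → ⊗-≈[]𝟙 (J.thetaFactor-admissible n) (binomial-admissible (3 * m + m) J.1≤C n))
               (block-admissible 1 (binomial-admissible (2 * m) 1≤2m)) ⟨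
    ∏∞ _
      ≈⟨ ∏∞-cong regroup ⟩
    ∏∞ (λ n → prod (λ i → b (i + n * 4)) 4 ⊗ binomial (2 * (2 * m) * suc n))
      ≈⟨ ∏∞-⊗ (block-admissible 3 (binomial-admissible m 1≤m)) (binomial-admissible (2 * (2 * m)) 1≤4m) ⟩
    ∏∞ (λ n → prod (λ i → b (i + n * 4)) 4) ⊗ euler (2 * (2 * m))
      ≈⟨ ⊗-cong (∏∞-blocks 3 (binomial-admissible m 1≤m)) ≈-refl ⟨
    E ⊗ euler (2 * (2 * m)) ∎

-- The lattice bijection

∑-++ : ∀ {X : Set} (xs ys : List X) h → ∑ (xs ++ ys) h ≡ ∑ xs h xor ∑ ys h
∑-++ []       ys h = refl
∑-++ (x ∷ xs) ys h = trans (cong (h x xor_) (∑-++ xs ys h)) (sym (Bool.xor-assoc (h x) _ _))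

∑-map : ∀ {X Y : Set} (f : X → Y) xs h → ∑ (map f xs) h ≡ ∑ xs (λ x → h (f x))
∑-map f []       h = refl
∑-map f (x ∷ xs) h = cong (h (f x) xor_) (∑-map f xs h)

∑-zero : ∀ {X : Set} (xs : List X) → ∑ xs (λ _ → false) ≡ false
∑-zero []       = refl
∑-zero (x ∷ xs) = ∑-zero xs

∑-swap : ∀ {X Y : Set} (xs : List X) (ys : List Y) (h : X → Y → Bool) →
         ∑ xs (λ x → ∑ ys (h x)) ≡ ∑ ys (λ y → ∑ xs (λ x → h x y))
∑-swap []       ys h = sym (∑-zero ys)
∑-swap (x ∷ xs) ys h = trans (cong (∑ ys (h x) xor_) (∑-swap xs ys h)) (sym (∑-xor ys (h x) _))

module _ {X : Set} (_≟_ : DecidableEquality X) where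

  ∑-indicator-∉ : ∀ {x} xs → All (λ y → ¬ (x ≡ y)) xs → ∑ xs (λ y → ⌊ x ≟ y ⌋) ≡ false
  ∑-indicator-∉ []       []         = refl
  ∑-indicator-∉ {x} (y ∷ xs) (x≢y ∷ x∉) with x ≟ y
  ... | yes x≡y = contradiction x≡y x≢y
  ... | no _    = ∑-indicator-∉ xs x∉

  ∑-indicator-∈ : ∀ {x xs} → Unique xs → x ∈ xs → ∑ xs (λ y → ⌊ x ≟ y ⌋) ≡ true
  ∑-indicator-∈ {x} {y ∷ xs} (y∉ ∷ u) x∈ with x ≟ y
  ∑-indicator-∈ {x} {y ∷ xs} (y∉ ∷ u) x∈         | yes refl = cong (true xor_) (∑-indicator-∉ xs y∉)
  ∑-indicator-∈ {x} {y ∷ xs} (y∉ ∷ u) (here p)   | no x≢y   = contradiction p x≢y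
  ∑-indicator-∈ {x} {y ∷ xs} (y∉ ∷ u) (there x∈) | no _     = ∑-indicator-∈ u x∈

module _ {X Y : Set} (_≟X_ : DecidableEquality X) (_≟Y_ : DecidableEquality Y) (bij : X ↔ Y)
         {p : X → Bool} {r : Y → Bool} (r∘to : ∀ x → r (Inverse.to bij x) ≡ p x)
         {xs : List X} {ys : List Y} (uniqueX : Unique xs) (uniqueY : Unique ys)
         (supportX : ∀ x → p x ≡ true → x ∈ xs) (supportY : ∀ y → r y ≡ true → y ∈ ys) where

  open Inverse bij using (to; from; strictlyInverseˡ; strictlyInverseʳ)

  -- Both sides count the pairs on the graph of the bijection, summed in the two possible orders.
  -- The lists only have to contain the supports, so a bijection of infinite lattices can be used on
  -- boxes that it does not map to each other.
  ∑-bijection : ∑ xs p ≡ ∑ ys r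
  ∑-bijection = begin
    ∑ xs p                                         ≡⟨ ∑-cong xs (λ x _ → expandX x) ⟩
    ∑ xs (λ x → ∑ ys (λ y → p x ∧ ⌊ to x ≟Y y ⌋))  ≡⟨ ∑-swap xs ys _ ⟩
    ∑ ys (λ y → ∑ xs (λ x → p x ∧ ⌊ to x ≟Y y ⌋))  ≡⟨ ∑-cong ys (λ y _ → ∑-cong xs (λ x _ → flip x y)) ⟩
    ∑ ys (λ y → ∑ xs (λ x → r y ∧ ⌊ from y ≟X x ⌋)) ≡⟨ ∑-cong ys (λ y _ → sym (expandY y)) ⟩
    ∑ ys r                                         ∎
    where
    open ≡-Reasoning
    expandX : ∀ x → p x ≡ ∑ ys (λ y → p x ∧ ⌊ to x ≟Y y ⌋)
    expandX x with p x in eq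
    ... | true  = sym (∑-indicator-∈ _≟Y_ uniqueY (supportY (to x) (trans (r∘to x) eq)))
    ... | false = sym (∑-zero ys)
    expandY : ∀ y → r y ≡ ∑ xs (λ x → r y ∧ ⌊ from y ≟X x ⌋)
    expandY y with r y in eq
    ... | true  = sym (∑-indicator-∈ _≟X_ uniqueX (supportX (from y)
                    (trans (sym (r∘to (from y))) (trans (cong r (strictlyInverseˡ y)) eq))))
    ... | false = sym (∑-zero xs)
    flip : ∀ x y → p x ∧ ⌊ to x ≟Y y ⌋ ≡ r y ∧ ⌊ from y ≟X x ⌋
    flip x y with to x ≟Y y | from y ≟X x
    ... | yes refl | yes _ = cong (_∧ true) (sym (r∘to x))
    ... | yes refl | no ¬q = contradiction (strictlyInverseʳ x) ¬q
    ... | no ¬q | yes refl = contradiction (strictlyInverseˡ y) ¬q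
    ... | no _  | no _     = trans (Bool.∧-zeroʳ (p x)) (sym (Bool.∧-zeroʳ (r y)))

∑ˢ-mono-⊗ : ∀ {X Y : Set} (xs : List X) (ys : List Y) (f : X → ℕ) (g : Y → ℕ) →
            ∑ˢ xs (λ x → mono (f x)) ⊗ ∑ˢ ys (λ y → mono (g y))
            ≈ ∑ˢ (cartesianProduct xs ys) (λ (x , y) → mono (f x + g y))
∑ˢ-mono-⊗ []       ys f g = mk (⊗-zeroˡ _)
∑ˢ-mono-⊗ (x ∷ xs) ys f g = begin
  (mono (f x) ⊕ ∑ˢ xs (λ x → mono (f x))) ⊗ Y
    ≈⟨ mk (⊗-distribʳ Y (mono (f x)) (∑ˢ xs (λ x → mono (f x)))) ⟩
  mono (f x) ⊗ Y ⊕ ∑ˢ xs (λ x → mono (f x)) ⊗ Y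
    ≈⟨ ⊕-cong (≈-trans (⊗-∑ˢ (mono (f x)) ys _) (∑ˢ-cong ys (λ y _ → ≈-sym (mono-+ (f x) (g y))))) (∑ˢ-mono-⊗ xs ys f g) ⟩
  ∑ˢ ys (λ y → mono (f x + g y)) ⊕ ∑ˢ (cartesianProduct xs ys) (λ (x , y) → mono (f x + g y))
    ≈⟨ mk (λ k → trans (∑-++ (map (x ,_) ys) (cartesianProduct xs ys) _) (cong (_xor _) (∑-map (x ,_) ys _))) ⟨
  ∑ˢ (cartesianProduct (x ∷ xs) ys) (λ (x , y) → mono (f x + g y)) ∎
  where
  open SetoidReasoning ≈-setoid
  Y : Series₂
  Y = ∑ˢ ys (λ y → mono (g y))

interval-unique : ∀ n → Unique (interval n)
interval-unique zero    = [] ∷ []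
interval-unique (suc n) = ((λ ()) ∷ outside (+ suc n) ℕ.≤-refl) ∷ outside -[1+ n ] ℕ.≤-refl ∷ interval-unique n
  where
  outside : ∀ k → n < ∣ k ∣ → All (λ y → ¬ (k ≡ y)) (interval n)
  outside k n<∣k∣ = All.tabulate (λ { k∈ refl → ℕ.<⇒≱ n<∣k∣ (∈-interval⁻ k∈) })

-- Residue classes and the Gaussian integers

fromDigit : ∀ d → Fin d × ℤ → ℤ
fromDigit d (r , q) = + toℕ r ℤ.+ q ℤ.* + d

-- The two digits differ by a multiple of d that is smaller than d in absolute value, hence by 0.
fromDigit-injective : ∀ d {x y} → fromDigit d x ≡ fromDigit d y → x ≡ y
fromDigit-injective d@(suc _) {r , q} {r′ , q′} eq = cong₂ _,_ r≡r′ q≡q′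
  where
  difference : toℕ r ⊖ toℕ r′ ≡ (q′ ℤ.- q) ℤ.* + d
  difference = begin
    toℕ r ⊖ toℕ r′            ≡⟨ ℤ.m-n≡m⊖n (toℕ r) (toℕ r′) ⟨
    + toℕ r ℤ.- + toℕ r′      ≡⟨ solveℤ 4 (λ r r′ q d → r Z.:- r′ Z.:= (r Z.:+ q Z.:* d) Z.:- r′ Z.:- q Z.:* d) refl (+ toℕ r) (+ toℕ r′) q (+ d) ⟩
    fromDigit d (r , q) ℤ.- + toℕ r′ ℤ.- q ℤ.* + d
                              ≡⟨ cong (λ x → x ℤ.- + toℕ r′ ℤ.- q ℤ.* + d) eq ⟩
    fromDigit d (r′ , q′) ℤ.- + toℕ r′ ℤ.- q ℤ.* + d
                              ≡⟨ solveℤ 4 (λ r′ q q′ d → (r′ Z.:+ q′ Z.:* d) Z.:- r′ Z.:- q Z.:* d Z.:= (q′ Z.:- q) Z.:* d) refl (+ toℕ r′) q q′ (+ d) ⟩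
    (q′ ℤ.- q) ℤ.* + d        ∎
    where open ≡-Reasoning
  small : ∣ q′ ℤ.- q ∣ * d < 1 * d
  small = begin-strict
    ∣ q′ ℤ.- q ∣ * d          ≡⟨ ℤ.abs-* (q′ ℤ.- q) (+ d) ⟨
    ∣ (q′ ℤ.- q) ℤ.* + d ∣    ≡⟨ cong ∣_∣ difference ⟨
    ∣ toℕ r ⊖ toℕ r′ ∣        ≤⟨ ℤ.∣m⊝n∣≤m⊔n (toℕ r) (toℕ r′) ⟩
    toℕ r ℕ.⊔ toℕ r′          <⟨ ℕ.⊔-lub (Fin.toℕ<n r) (Fin.toℕ<n r′) ⟩
    d                         ≡⟨ ℕ.*-identityˡ d ⟨
    1 * d                     ∎
    where open ℕ.≤-Reasoning
  q′-q≡0 : q′ ℤ.- q ≡ + 0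
  q′-q≡0 = ℤ.∣i∣≡0⇒i≡0 (ℕ.n<1⇒n≡0 (ℕ.*-cancelʳ-< d _ 1 small))
  q≡q′ : q ≡ q′
  q≡q′ = sym (ℤ.i-j≡0⇒i≡j q′ q q′-q≡0)
  r≡r′ : r ≡ r′
  r≡r′ = Fin.toℕ-injective (ℤ.+-injective (ℤ.i-j≡0⇒i≡j (+ toℕ r) (+ toℕ r′)
    (trans (ℤ.m-n≡m⊖n (toℕ r) (toℕ r′)) (trans difference (cong (ℤ._* + d) q′-q≡0)))))

digit : ∀ d → .{{_ : ℕ.NonZero d}} → ℤ ↔ (Fin d × ℤ)
digit d = mk↔ₛ′ to (fromDigit d) (λ x → fromDigit-injective d (from-to (fromDigit d x))) from-to
  where
  to : ℤ → Fin d × ℤ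
  to k = fromℕ< (n%ℕd<d k d) , k /ℕ d
  from-to : ∀ k → fromDigit d (to k) ≡ k
  from-to k = trans (cong (λ r → + r ℤ.+ (k /ℕ d) ℤ.* + d) (Fin.toℕ-fromℕ< (n%ℕd<d k d))) (sym (a≡a%ℕn+[a/ℕn]*n k d))

-- The coordinate m = k - 2l detects divisibility by 2 + i: since i is -2 modulo 2 + i, (4k + 1) +
-- (4l + 1)i reduces to 4m - 1, which is divisible by 5 exactly when m is 4 modulo 5.
shear : (ℤ × ℤ) ↔ (ℤ × ℤ)
shear = mk↔ₛ′ (λ (m , l) → m ℤ.+ + 2 ℤ.* l , l) (λ (k , l) → k ℤ.- + 2 ℤ.* l , l)
  (λ (k , l) → cong (_, l) (solveℤ 2 (λ k l → (k Z.:- Z.con (+ 2) Z.:* l) Z.:+ Z.con (+ 2) Z.:* l Z.:= k) refl k l))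
  (λ (m , l) → cong (_, l) (solveℤ 2 (λ m l → (m Z.:+ Z.con (+ 2) Z.:* l) Z.:- Z.con (+ 2) Z.:* l Z.:= m) refl m l))

-- Five copies of ℤ² on each side: four parity classes of (a , b) and the one class of (s , t),
-- against five classes of k - 2l modulo 5. Copies are matched by integral affine maps.
Digits₂ Digits₅ : Set
Digits₂ = ((Fin 2 × ℤ) × (Fin 2 × ℤ)) ⊎ (ℤ × ℤ)
Digits₅ = (Fin 5 × ℤ) × ℤ

-- (k , l) has class r = k - 2l modulo 5. The class r = 4 consists of the multiples of the fixed prime;
-- each other class matches one pair of parities of (a , b), which determines the unit that restores
-- both coordinates to 1 modulo 4.
residues : Digits₂ ↔ Digits₅
residues = mk↔ₛ′ to from to-from from-to
  where
  to : Digits₂ → Digits₅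
  to (inj₁ ((0F , a) , (0F , b))) = (0F , ℤ.- b)            , a ℤ.+ + 2 ℤ.* b
  to (inj₁ ((0F , a) , (1F , b))) = (1F , a)                , b ℤ.- + 2 ℤ.* a
  to (inj₁ ((1F , a) , (0F , b))) = (2F , ℤ.- (+ 1) ℤ.- a)  , + 1 ℤ.+ + 2 ℤ.* a ℤ.- b
  to (inj₁ ((1F , a) , (1F , b))) = (3F , b)                , ℤ.- (+ 2) ℤ.- a ℤ.- + 2 ℤ.* b
  to (inj₂ (s , t))               = (4F , ℤ.- (+ 1) ℤ.- s)  , + 2 ℤ.* s ℤ.- t
  from : Digits₅ → Digits₂
  from ((0F , c) , l) = inj₁ ((0F , l ℤ.+ + 2 ℤ.* c) , (0F , ℤ.- c))
  from ((1F , c) , l) = inj₁ ((0F , c) , (1F , l ℤ.+ + 2 ℤ.* c))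
  from ((2F , c) , l) = inj₁ ((1F , ℤ.- (+ 1) ℤ.- c) , (0F , ℤ.- (+ 1) ℤ.- + 2 ℤ.* c ℤ.- l))
  from ((3F , c) , l) = inj₁ ((1F , ℤ.- (+ 2) ℤ.- + 2 ℤ.* c ℤ.- l) , (1F , c))
  from ((4F , c) , l) = inj₂ (ℤ.- (+ 1) ℤ.- c , ℤ.- (+ 2) ℤ.- + 2 ℤ.* c ℤ.- l)
  i d : ∀ {n} → Z.Polynomial n
  i = Z.con (+ 1)
  d = Z.con (+ 2)
  to-from : ∀ y → to (from y) ≡ y
  to-from ((0F , c) , l) = cong₂ (λ c l → (0F , c) , l) (ℤ.neg-involutive c)
    (solveℤ 2 (λ c l → (l Z.:+ d Z.:* c) Z.:+ d Z.:* (Z.:- c) Z.:= l) refl c l)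
  to-from ((1F , c) , l) = cong (λ l → (1F , c) , l)
    (solveℤ 2 (λ c l → (l Z.:+ d Z.:* c) Z.:- d Z.:* c Z.:= l) refl c l)
  to-from ((2F , c) , l) = cong₂ (λ c l → (2F , c) , l)
    (solveℤ 1 (λ c → Z.:- i Z.:- (Z.:- i Z.:- c) Z.:= c) refl c)
    (solveℤ 2 (λ c l → i Z.:+ d Z.:* (Z.:- i Z.:- c) Z.:- (Z.:- i Z.:- d Z.:* c Z.:- l) Z.:= l) refl c l)
  to-from ((3F , c) , l) = cong (λ l → (3F , c) , l)
    (solveℤ 2 (λ c l → Z.:- d Z.:- (Z.:- d Z.:- d Z.:* c Z.:- l) Z.:- d Z.:* c Z.:= l) refl c l)
  to-from ((4F , c) , l) = cong₂ (λ c l → (4F , c) , l)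
    (solveℤ 1 (λ c → Z.:- i Z.:- (Z.:- i Z.:- c) Z.:= c) refl c)
    (solveℤ 2 (λ c l → d Z.:* (Z.:- i Z.:- c) Z.:- (Z.:- d Z.:- d Z.:* c Z.:- l) Z.:= l) refl c l)
  from-to : ∀ x → from (to x) ≡ x
  from-to (inj₁ ((0F , a) , (0F , b))) = cong₂ (λ a b → inj₁ ((0F , a) , (0F , b)))
    (solveℤ 2 (λ a b → a Z.:+ d Z.:* b Z.:+ d Z.:* (Z.:- b) Z.:= a) refl a b) (ℤ.neg-involutive b)
  from-to (inj₁ ((0F , a) , (1F , b))) = cong (λ b → inj₁ ((0F , a) , (1F , b)))
    (solveℤ 2 (λ a b → b Z.:- d Z.:* a Z.:+ d Z.:* a Z.:= b) refl a b)
  from-to (inj₁ ((1F , a) , (0F , b))) = cong₂ (λ a b → inj₁ ((1F , a) , (0F , b)))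
    (solveℤ 1 (λ a → Z.:- i Z.:- (Z.:- i Z.:- a) Z.:= a) refl a)
    (solveℤ 2 (λ a b → Z.:- i Z.:- d Z.:* (Z.:- i Z.:- a) Z.:- (i Z.:+ d Z.:* a Z.:- b) Z.:= b) refl a b)
  from-to (inj₁ ((1F , a) , (1F , b))) = cong (λ a → inj₁ ((1F , a) , (1F , b)))
    (solveℤ 2 (λ a b → Z.:- d Z.:- d Z.:* b Z.:- (Z.:- d Z.:- a Z.:- d Z.:* b) Z.:= a) refl a b)
  from-to (inj₂ (s , t)) = cong₂ (λ s t → inj₂ (s , t))
    (solveℤ 1 (λ s → Z.:- i Z.:- (Z.:- i Z.:- s) Z.:= s) refl s)
    (solveℤ 2 (λ s t → Z.:- d Z.:- d Z.:* (Z.:- i Z.:- s) Z.:- (d Z.:* s Z.:- t) Z.:= t) refl s t)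

Lattices : Set
Lattices = (ℤ × ℤ) ⊎ (ℤ × ℤ)

digits₂ : Lattices ↔ Digits₂
digits₂ = (digit 2 ×-↔ digit 2) ⊎-↔ ↔-refl

digits₅ : (ℤ × ℤ) ↔ Digits₅
digits₅ = ↔-trans (↔-sym shear) (digit 5 ×-↔ ↔-refl)

lattices : Lattices ↔ (ℤ × ℤ)
lattices = ↔-trans digits₂ (↔-trans residues (↔-sym digits₅))

weight : Lattices → ℕ
weight (inj₁ (a , b)) = exponent 4 1 a + exponent 3 2 b
weight (inj₂ (s , t)) = 1 + (exponent 15 5 s + exponent 15 5 t)

weight′ : ℤ × ℤ → ℕ
weight′ (k , l) = exponent 3 1 k + exponent 3 1 l

quadratic : ℕ → ℕ → ℤ → ℤ
quadratic A B k = + A ℤ.* (k ℤ.* (k ℤ.+ + 1)) ℤ.+ + B ℤ.* (ℤ.- k ℤ.* (ℤ.- k ℤ.+ + 1))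

2*exponent-+ : ∀ A B A′ B′ k l →
  + 2 ℤ.* + (exponent A B k + exponent A′ B′ l) ≡ quadratic A B k ℤ.+ quadratic A′ B′ l
2*exponent-+ A B A′ B′ k l = trans (cong (+ 2 ℤ.*_) (ℤ.pos-+ (exponent A B k) (exponent A′ B′ l)))
  (trans (ℤ.*-distribˡ-+ (+ 2) (+ exponent A B k) (+ exponent A′ B′ l)) (cong₂ ℤ._+_ (2*exponent A B k) (2*exponent A′ B′ l)))

quadraticWeight : Lattices → ℤ
quadraticWeight (inj₁ (a , b)) = quadratic 4 1 a ℤ.+ quadratic 3 2 b
quadraticWeight (inj₂ (s , t)) = + 2 ℤ.+ (quadratic 15 5 s ℤ.+ quadratic 15 5 t)

quadraticWeight′ : ℤ × ℤ → ℤ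
quadraticWeight′ (k , l) = quadratic 3 1 k ℤ.+ quadratic 3 1 l

2*weight : ∀ x → + 2 ℤ.* + weight x ≡ quadraticWeight x
2*weight (inj₁ (a , b)) = 2*exponent-+ 4 1 3 2 a b
2*weight (inj₂ (s , t)) = trans (cong (+ 2 ℤ.*_) (ℤ.pos-+ 1 (exponent 15 5 s + exponent 15 5 t)))
  (trans (ℤ.*-distribˡ-+ (+ 2) (+ 1) (+ (exponent 15 5 s + exponent 15 5 t)))
         (cong (λ x → + 2 ℤ.+ x) (2*exponent-+ 15 5 15 5 s t)))

2*weight′ : ∀ y → + 2 ℤ.* + weight′ y ≡ quadraticWeight′ y
2*weight′ (k , l) = 2*exponent-+ 3 1 3 1 k l

-- This is multiplicativity of the norm. Let z = (4k + 1) + (4l + 1)i, and take a and b before the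
-- split by parity. Then (10a + 3) + (10b + 1)i = u(2 - i)z with u = 1, i, -i, -1 in the classes 0,
-- 1, 2, 3, and in class 4, z = (-1 + 2i)((4s + 1) + (4t + 1)i), where -1 + 2i = i(2 + i).
quadraticWeight-residues : ∀ v → quadraticWeight (Inverse.from digits₂ v) ≡ quadraticWeight′ (Inverse.from digits₅ (Inverse.to residues v))
quadraticWeight-residues = go
  where
  i d : ∀ {n} → Z.Polynomial n
  i = Z.con (+ 1)
  d = Z.con (+ 2)
  quad : ∀ {n} → ℕ → ℕ → Z.Polynomial n → Z.Polynomial n
  quad A B x = Z.con (+ A) Z.:* (x Z.:* (x Z.:+ i)) Z.:+ Z.con (+ B) Z.:* (Z.:- x Z.:* (Z.:- x Z.:+ i))
  dig₂ : ∀ {n} → ℕ → Z.Polynomial n → Z.Polynomial n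
  dig₂ r x = Z.con (+ r) Z.:+ x Z.:* Z.con (+ 2)
  target : ∀ {n} → ℕ → Z.Polynomial n → Z.Polynomial n → Z.Polynomial n
  target r c l = quad 3 1 (Z.con (+ r) Z.:+ c Z.:* Z.con (+ 5) Z.:+ d Z.:* l) Z.:+ quad 3 1 l
  go : ∀ v → quadraticWeight (Inverse.from digits₂ v) ≡ quadraticWeight′ (Inverse.from digits₅ (Inverse.to residues v))
  go (inj₁ ((0F , a) , (0F , b))) = solveℤ 2 (λ a b →
        quad 4 1 (dig₂ 0 a) Z.:+ quad 3 2 (dig₂ 0 b) Z.:=
        target 0 (Z.:- b) (a Z.:+ d Z.:* b)) refl a b
  go (inj₁ ((0F , a) , (1F , b))) = solveℤ 2 (λ a b →
        quad 4 1 (dig₂ 0 a) Z.:+ quad 3 2 (dig₂ 1 b) Z.:=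
        target 1 a (b Z.:- d Z.:* a)) refl a b
  go (inj₁ ((1F , a) , (0F , b))) = solveℤ 2 (λ a b →
        quad 4 1 (dig₂ 1 a) Z.:+ quad 3 2 (dig₂ 0 b) Z.:=
        target 2 (Z.:- i Z.:- a) (i Z.:+ d Z.:* a Z.:- b)) refl a b
  go (inj₁ ((1F , a) , (1F , b))) = solveℤ 2 (λ a b →
        quad 4 1 (dig₂ 1 a) Z.:+ quad 3 2 (dig₂ 1 b) Z.:=
        target 3 b (Z.:- d Z.:- a Z.:- d Z.:* b)) refl a b
  go (inj₂ (s , t)) = solveℤ 2 (λ s t →
        d Z.:+ (quad 15 5 s Z.:+ quad 15 5 t) Z.:=
        target 4 (Z.:- i Z.:- s) (d Z.:* s Z.:- t)) refl s t

weight-residues : ∀ v → weight (Inverse.from digits₂ v) ≡ weight′ (Inverse.from digits₅ (Inverse.to residues v))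
weight-residues v = 2*-injective (trans (2*weight x) (trans (quadraticWeight-residues v) (sym (2*weight′ y))))
  where
  x : Lattices
  x = Inverse.from digits₂ v
  y : ℤ × ℤ
  y = Inverse.from digits₅ (Inverse.to residues v)

weight-lattices : ∀ x → weight′ (Inverse.to lattices x) ≡ weight x
weight-lattices x = trans (sym (weight-residues (Inverse.to digits₂ x))) (cong weight (Inverse.strictlyInverseʳ digits₂ x))

-- The key identity

theta : ℕ → ℕ → ℕ → Series₂
theta A B n = ∑ˢ (interval n) (λ k → mono (exponent A B k))

-- By `exponent-≥`, all lattice points of weight n on either side have coordinates in `interval n`,
-- so in degree n the truncated sums lose nothing.
theta-lattices : ∀ n → (theta 4 1 n ⊗ theta 3 2 n ⊕ mono 1 ⊗ (theta 15 5 n ⊗ theta 15 5 n)) n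
                       ≡ (theta 3 1 n ⊗ theta 3 1 n) n
theta-lattices n = begin
  (theta 4 1 n ⊗ theta 3 2 n ⊕ mono 1 ⊗ (theta 15 5 n ⊗ theta 15 5 n)) n
    ≡⟨ cong₂ _xor_ (coeff (∑ˢ-mono-⊗ I I (exponent 4 1) (exponent 3 2)) n) (coeff shifted n) ⟩
  ∑ (cartesianProduct I I) (λ x → n ≡ᵇ weight (inj₁ x)) xor ∑ (cartesianProduct I I) (λ x → n ≡ᵇ weight (inj₂ x))
    ≡⟨ cong₂ _xor_ (∑-map inj₁ (cartesianProduct I I) _) (∑-map inj₂ (cartesianProduct I I) _) ⟨
  ∑ (map inj₁ (cartesianProduct I I)) (λ x → n ≡ᵇ weight x) xor ∑ (map inj₂ (cartesianProduct I I)) (λ x → n ≡ᵇ weight x)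
    ≡⟨ ∑-++ (map inj₁ (cartesianProduct I I)) _ _ ⟨
  ∑ xs (λ x → n ≡ᵇ weight x)
    ≡⟨ ∑-bijection (Sum.≡-dec _≟²_ _≟²_) _≟²_ lattices (λ x → cong (n ≡ᵇ_) (weight-lattices x))
         unique-xs unique-box support-xs support-box ⟩
  ∑ (cartesianProduct I I) (λ y → n ≡ᵇ weight′ y)
    ≡⟨ coeff (∑ˢ-mono-⊗ I I (exponent 3 1) (exponent 3 1)) n ⟨
  (theta 3 1 n ⊗ theta 3 1 n) n ∎
  where
  open ≡-Reasoning
  I : List ℤ
  I = interval n
  xs : List Lattices
  xs = map inj₁ (cartesianProduct I I) ++ map inj₂ (cartesianProduct I I)
  _≟²_ : DecidableEquality (ℤ × ℤ)
  _≟²_ = Product.≡-dec ℤ._≟_ ℤ._≟_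
  shifted : mono 1 ⊗ (theta 15 5 n ⊗ theta 15 5 n) ≈ ∑ˢ (cartesianProduct I I) (λ x → mono (weight (inj₂ x)))
  shifted = ≈-trans (⊗-cong ≈-refl (∑ˢ-mono-⊗ I I (exponent 15 5) (exponent 15 5)))
    (≈-trans (⊗-∑ˢ (mono 1) (cartesianProduct I I) _)
      (∑ˢ-cong (cartesianProduct I I) (λ (s , t) _ → ≈-sym (mono-+ 1 (exponent 15 5 s + exponent 15 5 t)))))
  unique-box : Unique (cartesianProduct I I)
  unique-box = Unique.cartesianProduct⁺ (interval-unique n) (interval-unique n)
  disjoint : Disjoint (map inj₁ (cartesianProduct I I)) (map inj₂ (cartesianProduct I I))
  disjoint (p , q) with ∈-map⁻ inj₁ p | ∈-map⁻ inj₂ q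
  ... | _ , _ , refl | _ , _ , ()
  unique-xs : Unique xs
  unique-xs = Unique.++⁺ (Unique.map⁺ (λ { refl → refl }) unique-box) (Unique.map⁺ (λ { refl → refl }) unique-box) disjoint
  ≡ᵇ-sound : ∀ {m} → (n ≡ᵇ m) ≡ true → m ≤ n
  ≡ᵇ-sound {m} eq = ℕ.≤-reflexive (sym (ℕ.≡ᵇ⇒≡ n m (subst T (sym eq) _)))
  in-box : ∀ A B A′ B′ k l → 1 ≤ A → 1 ≤ B → 1 ≤ A′ → 1 ≤ B′ → exponent A B k + exponent A′ B′ l ≤ n →
           (k , l) ∈ cartesianProduct I I
  in-box A B A′ B′ k l hA hB hA′ hB′ bound = ∈-cartesianProduct⁺
    (∈-interval⁺ n k (ℕ.≤-trans (exponent-≥ A B k hA hB) (ℕ.≤-trans (ℕ.m≤m+n _ _) bound)))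
    (∈-interval⁺ n l (ℕ.≤-trans (exponent-≥ A′ B′ l hA′ hB′) (ℕ.≤-trans (ℕ.m≤n+m _ (exponent A B k)) bound)))
  support-xs : ∀ x → (n ≡ᵇ weight x) ≡ true → x ∈ xs
  support-xs (inj₁ (a , b)) eq = ∈-++⁺ˡ (∈-map⁺ inj₁
    (in-box 4 1 3 2 a b (s≤s z≤n) (s≤s z≤n) (s≤s z≤n) (s≤s z≤n) (≡ᵇ-sound eq)))
  support-xs (inj₂ (s , t)) eq = ∈-++⁺ʳ (map inj₁ (cartesianProduct I I)) (∈-map⁺ inj₂
    (in-box 15 5 15 5 s t (s≤s z≤n) (s≤s z≤n) (s≤s z≤n) (s≤s z≤n) (ℕ.≤-trans (ℕ.n≤1+n _) (≡ᵇ-sound eq))))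
  support-box : ∀ y → (n ≡ᵇ weight′ y) ≡ true → y ∈ cartesianProduct I I
  support-box (k , l) eq = in-box 3 1 3 1 k l (s≤s z≤n) (s≤s z≤n) (s≤s z≤n) (s≤s z≤n) (≡ᵇ-sound eq)

theta-3m-m : ∀ m n → 1 ≤ m → theta (3 * m) m n ≈[ n ] pow₂ (euler m) 3
theta-3m-m m n 1≤m = ≈[]-trans
  (Jacobi.triple-product (3 * m) m (ℕ.≤-trans 1≤m (ℕ.m≤m+n m _)) 1≤m n) (≈⇒≈[] (tripleProduct-3m-m m 1≤m))

euler-1-5 : euler 1 ⊗ euler 5 ≈ pow₂ (euler 1) 6 ⊕ mono 1 ⊗ pow₂ (euler 5) 6
euler-1-5 = begin
  E₁ ⊗ E₅
    ≈⟨ solve₂ 2 (λ p r → p := (p :+ r) :+ r) ≈-refl (E₁ ⊗ E₅) (mono 1 ⊗ pow₂ E₅ 6) ⟩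
  (E₁ ⊗ E₅ ⊕ mono 1 ⊗ pow₂ E₅ 6) ⊕ mono 1 ⊗ pow₂ E₅ 6
    ≈⟨ ⊕-cong {E₁ ⊗ E₅ ⊕ mono 1 ⊗ pow₂ E₅ 6} (mk λ n → coeff≤ (identity n) n ℕ.≤-refl) (≈-refl {mono 1 ⊗ pow₂ E₅ 6}) ⟩
  pow₂ E₁ 6 ⊕ mono 1 ⊗ pow₂ E₅ 6 ∎
  where
  open SetoidReasoning ≈-setoid
  E₁ E₅ : Series₂
  E₁ = euler 1
  E₅ = euler 5
  θ-31 : ∀ n → theta 3 1 n ⊗ theta 3 1 n ≈[ n ] pow₂ E₁ 6
  θ-31 n = ≈[]-trans (⊗-cong[] (theta-3m-m 1 n (s≤s z≤n)) (theta-3m-m 1 n (s≤s z≤n)))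
    (≈⇒≈[] (solve₂ 1 (λ e → e :^ 3 :* e :^ 3 := e :^ 6) ≈-refl E₁))
  θ-155 : ∀ n → theta 15 5 n ⊗ theta 15 5 n ≈[ n ] pow₂ E₅ 6
  θ-155 n = ≈[]-trans (⊗-cong[] (theta-3m-m 5 n (s≤s z≤n)) (theta-3m-m 5 n (s≤s z≤n)))
    (≈⇒≈[] (solve₂ 1 (λ e → e :^ 3 :* e :^ 3 := e :^ 6) ≈-refl E₅))
  θ-41-32 : ∀ n → theta 4 1 n ⊗ theta 3 2 n ≈[ n ] E₁ ⊗ E₅
  θ-41-32 n = ≈[]-trans (⊗-cong[] (J₄₁.triple-product n) (J₃₂.triple-product n)) (≈⇒≈[] tripleProduct-41-32)
  identity : ∀ n → E₁ ⊗ E₅ ⊕ mono 1 ⊗ pow₂ E₅ 6 ≈[ n ] pow₂ E₁ 6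
  -- `theta-lattices` controls only the degree equal to the window, so each degree k is read with
  -- its own window k.
  identity n = mk λ k _ → trans
    (sym (coeff≤ (⊕-cong[] (θ-41-32 k) (⊗-cong[] (≈⇒≈[] (≈-refl {mono 1})) (θ-155 k))) k ℕ.≤-refl))
    (trans (theta-lattices k) (coeff≤ (θ-31 k) k ℕ.≤-refl))

-- Parity of the coefficients of j₁₀

module J10-parity where
  open SetoidReasoning ≈-setoid

  E₁ E₅ I₁ I₅ w : Series₂
  E₁ = euler 1
  E₅ = euler 5
  I₁ = euler⁻¹ 1
  I₅ = euler⁻¹ 5
  w = E₁ ⊗ I₅

  E₁I₁ : E₁ ⊗ I₁ ≈ 𝟙
  E₁I₁ = euler-inverse 1 (s≤s z≤n)

  E₅I₅ : E₅ ⊗ I₅ ≈ 𝟙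
  E₅I₅ = euler-inverse 5 (s≤s z≤n)

  positive : PositiveLevels j10Exps
  positive = s≤s z≤n ∷ s≤s z≤n ∷ s≤s z≤n ∷ s≤s z≤n ∷ []

  pow₂-𝟙 : ∀ e → pow₂ 𝟙 e ≈ 𝟙
  pow₂-𝟙 zero    = ≈-refl
  pow₂-𝟙 (suc e) = ≈-trans (⊗-identityˡ _) (pow₂-𝟙 e)

  pow₂-E₅I₅ : ∀ e → pow₂ (E₅ ⊗ I₅) e ≈ 𝟙
  pow₂-E₅I₅ e = ≈-trans (pow₂-cong e E₅I₅) (pow₂-𝟙 e)

  series : Series₂
  series = reduce (etaProdCoeff j10Exps)

  -- Doubling the level squares the product, so E 2 / E 1 becomes E 1 and (E 5 / E 10)⁵ becomes (E
  -- 5)⁻⁵.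
  series≈ : series ≈ E₁ ⊗ pow₂ I₅ 5
  series≈ = begin
    series
      ≈⟨ reduce-etaProdCoeff positive ⟩
    pow₂ (euler 2) 1 ⊗ (pow₂ E₅ 5 ⊗ (pow₂ I₁ 1 ⊗ (pow₂ (euler⁻¹ 10) 5 ⊗ 𝟙)))
      ≈⟨ ⊗-cong (pow₂-cong 1 (euler-double 1 (s≤s z≤n))) (⊗-cong (≈-refl {pow₂ E₅ 5})
           (⊗-cong (≈-refl {pow₂ I₁ 1}) (⊗-cong (pow₂-cong 5 (euler⁻¹-double 5 (s≤s z≤n))) (≈-refl {𝟙})))) ⟩
    pow₂ (pow₂ E₁ 2) 1 ⊗ (pow₂ E₅ 5 ⊗ (pow₂ I₁ 1 ⊗ (pow₂ (pow₂ I₅ 2) 5 ⊗ 𝟙)))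
      ≈⟨ solve₂ 4 (λ e₁ e₅ i₁ i₅ → (e₁ :^ 2) :^ 1 :* (e₅ :^ 5 :* (i₁ :^ 1 :* ((i₅ :^ 2) :^ 5 :* con true)))
                    := (e₁ :* i₁) :* (e₅ :* i₅) :^ 5 :* (e₁ :* i₅ :^ 5)) ≈-refl E₁ E₅ I₁ I₅ ⟩
    (E₁ ⊗ I₁) ⊗ pow₂ (E₅ ⊗ I₅) 5 ⊗ (E₁ ⊗ pow₂ I₅ 5)
      ≈⟨ ⊗-cong (⊗-cong E₁I₁ (pow₂-E₅I₅ 5)) (≈-refl {E₁ ⊗ pow₂ I₅ 5}) ⟩
    (𝟙 ⊗ 𝟙) ⊗ (E₁ ⊗ pow₂ I₅ 5)
      ≈⟨ solve₂ 1 (λ x → con true :* con true :* x := x) ≈-refl (E₁ ⊗ pow₂ I₅ 5) ⟩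
    E₁ ⊗ pow₂ I₅ 5 ∎

  series-square : series ≈ pow₂ w 3 ⊗ pow₂ w 3 ⊕ mono 1
  series-square = begin
    series
      ≈⟨ series≈ ⟩
    E₁ ⊗ pow₂ I₅ 5
      ≈⟨ ⊗-identityʳ _ ⟨
    (E₁ ⊗ pow₂ I₅ 5) ⊗ 𝟙
      -- The inserted 1 supplies the E 5 that completes E 1 · E 5, ready for `euler-1-5`, and leaves
      -- (E 5)⁻⁶.
      ≈⟨ ⊗-cong (≈-refl {E₁ ⊗ pow₂ I₅ 5}) E₅I₅ ⟨
    (E₁ ⊗ pow₂ I₅ 5) ⊗ (E₅ ⊗ I₅)
      ≈⟨ solve₂ 3 (λ e₁ e₅ i₅ → (e₁ :* i₅ :^ 5) :* (e₅ :* i₅) := (e₁ :* e₅) :* i₅ :^ 6) ≈-refl E₁ E₅ I₅ ⟩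
    (E₁ ⊗ E₅) ⊗ pow₂ I₅ 6
      ≈⟨ ⊗-cong euler-1-5 (≈-refl {pow₂ I₅ 6}) ⟩
    (pow₂ E₁ 6 ⊕ mono 1 ⊗ pow₂ E₅ 6) ⊗ pow₂ I₅ 6
      ≈⟨ solve₂ 4 (λ q e₁ e₅ i₅ → (e₁ :^ 6 :+ q :* e₅ :^ 6) :* i₅ :^ 6
                    := (e₁ :* i₅) :^ 3 :* (e₁ :* i₅) :^ 3 :+ q :* (e₅ :* i₅) :^ 6) ≈-refl (mono 1) E₁ E₅ I₅ ⟩
    pow₂ w 3 ⊗ pow₂ w 3 ⊕ mono 1 ⊗ pow₂ (E₅ ⊗ I₅) 6
      ≈⟨ ⊕-cong (≈-refl {pow₂ w 3 ⊗ pow₂ w 3}) (≈-trans (⊗-cong (≈-refl {mono 1}) (pow₂-E₅I₅ 6)) (⊗-identityʳ (mono 1))) ⟩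
    pow₂ w 3 ⊗ pow₂ w 3 ⊕ mono 1 ∎

  -- Writing w³ as (E 1 · E 5) · (E 1)² / (E 5)⁴ allows a second use of `euler-1-5`.
  w-cube : pow₂ w 3 ≈ pow₂ (pow₂ E₁ 2 ⊗ I₅) 4 ⊕ mono 1 ⊗ ((E₁ ⊗ E₅) ⊗ (E₁ ⊗ E₅))
  w-cube = begin
    pow₂ w 3
      ≈⟨ ⊗-identityʳ _ ⟨
    pow₂ w 3 ⊗ 𝟙
      ≈⟨ ⊗-cong (≈-refl {pow₂ w 3}) E₅I₅ ⟨
    pow₂ w 3 ⊗ (E₅ ⊗ I₅)
      ≈⟨ solve₂ 3 (λ e₁ e₅ i₅ → (e₁ :* i₅) :^ 3 :* (e₅ :* i₅) := (e₁ :* e₅) :* (e₁ :^ 2 :* i₅ :^ 4)) ≈-refl E₁ E₅ I₅ ⟩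
    (E₁ ⊗ E₅) ⊗ (pow₂ E₁ 2 ⊗ pow₂ I₅ 4)
      ≈⟨ ⊗-cong euler-1-5 (≈-refl {pow₂ E₁ 2 ⊗ pow₂ I₅ 4}) ⟩
    (pow₂ E₁ 6 ⊕ mono 1 ⊗ pow₂ E₅ 6) ⊗ (pow₂ E₁ 2 ⊗ pow₂ I₅ 4)
      ≈⟨ solve₂ 4 (λ q e₁ e₅ i₅ → (e₁ :^ 6 :+ q :* e₅ :^ 6) :* (e₁ :^ 2 :* i₅ :^ 4)
                    := (e₁ :^ 2 :* i₅) :^ 4 :+ (q :* ((e₁ :* e₅) :* (e₁ :* e₅))) :* (e₅ :* i₅) :^ 4) ≈-refl (mono 1) E₁ E₅ I₅ ⟩
    pow₂ (pow₂ E₁ 2 ⊗ I₅) 4 ⊕ (mono 1 ⊗ ((E₁ ⊗ E₅) ⊗ (E₁ ⊗ E₅))) ⊗ pow₂ (E₅ ⊗ I₅) 4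
      ≈⟨ ⊕-cong (≈-refl {pow₂ (pow₂ E₁ 2 ⊗ I₅) 4})
           (≈-trans (⊗-cong (≈-refl {mono 1 ⊗ ((E₁ ⊗ E₅) ⊗ (E₁ ⊗ E₅))}) (pow₂-E₅I₅ 4)) (⊗-identityʳ _)) ⟩
    pow₂ (pow₂ E₁ 2 ⊗ I₅) 4 ⊕ mono 1 ⊗ ((E₁ ⊗ E₅) ⊗ (E₁ ⊗ E₅)) ∎

  w-cube-coeff : ∀ n → pow₂ w 3 (4 * n + 2) ≡ false
  w-cube-coeff n = trans (coeff w-cube (4 * n + 2)) (cong₂ _xor_
    (pow₂-4-coeff (pow₂ E₁ 2 ⊗ I₅) n 2 (s≤s z≤n) (s≤s (s≤s (s≤s z≤n))))
    (trans (cong (mono 1 ⊗ EE) (solveℕ 1 (λ n → N.con 4 N.:* n N.:+ N.con 2 N.:= N.con 2 N.:+ N.con 2 N.:* (N.con 2 N.:* n)) refl n))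
      (trans (mono-⊗-coeff-+ 1 EE (suc (2 * (2 * n)))) (square-odd (E₁ ⊗ E₅) (2 * n)))))
    where
    EE : Series₂
    EE = (E₁ ⊗ E₅) ⊗ (E₁ ⊗ E₅)

  series-odd : ∀ n → 1 ≤ n → series (suc (2 * n)) ≡ false
  -- A positive n puts the degree at 3 or more, away from the summand q.
  series-odd n@(suc _) _ = trans (coeff series-square (suc (2 * n))) (cong₂ _xor_ (square-odd (pow₂ w 3) n) refl)

  series-8n+4 : ∀ n → series (suc (8 * n + 3)) ≡ false
  series-8n+4 n = trans (cong series index) (trans (coeff series-square (2 * (4 * n + 2)))
    (cong₂ _xor_ (trans (square-even (pow₂ w 3) (4 * n + 2)) (w-cube-coeff n)) (cong (mono 1) index′)))
    where
    index : suc (8 * n + 3) ≡ 2 * (4 * n + 2)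
    index = solveℕ 1 (λ n → N.con 1 N.:+ (N.con 8 N.:* n N.:+ N.con 3) N.:= N.con 2 N.:* (N.con 4 N.:* n N.:+ N.con 2)) refl n
    -- The form 4 + 8n exposes a degree above 1, where `mono 1` computes to `false`.
    index′ : 2 * (4 * n + 2) ≡ 4 + 8 * n
    index′ = solveℕ 1 (λ n → N.con 2 N.:* (N.con 4 N.:* n N.:+ N.con 2) N.:= N.con 4 N.:+ N.con 8 N.:* n) refl n

-- `series` reduces q (j₁₀ + 1), whence the shift by one; the subtracted 1 affects only index 0.
parity-J10 : ∀ n → 1 ≤ n → parity (J10 n) ≡ J10-parity.series (suc n)
parity-J10 (suc n) _ = cong parity (ℤ.+-identityʳ (etaProdCoeff j10Exps (2 + n)))

theorem4p5 : (n : ℕ) → 1 ≤ n →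
    ((+ 2 ∣ J10 (2 * n)) × (+ 2 ∣ J10 (8 * n + 3)))
    × ((i : Fin 3) → + 2 ∣ J10* (4 * n + toℕ i))
theorem4p5 n 1≤n =
    ( 2∣⇐parity (J10 (2 * n)) (trans (parity-J10 (2 * n) 1≤2n) (J10-parity.series-odd n 1≤n))
    , 2∣⇐parity (J10 (8 * n + 3)) (trans (parity-J10 (8 * n + 3) 1≤8n+3) (J10-parity.series-8n+4 n)) )
  , λ i → 2∣⇐parity (J10* (4 * n + toℕ i)) (J10*-even n 1≤n (toℕ i) (Fin.toℕ<n i))
  where
  1≤2n : 1 ≤ 2 * n
  1≤2n = ℕ.≤-trans 1≤n (ℕ.m≤m+n n _)
  1≤8n+3 : 1 ≤ 8 * n + 3
  1≤8n+3 = ℕ.≤-trans (s≤s z≤n) (ℕ.m≤n+m 3 (8 * n))
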